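{- Let $d\geq 2$ be a fixed integer and let $p\in\mathbb{R}[x]$ be a nonconstant polynomial with positive real coefficients summing to $1$; that is, $p=p_0+p_1x+\cdots+p_mx^m$ with $m\geq 1$, $p_i>0$ for all $0\leq i\leq m$, and $\sum_{i=0}^m p_i=1$. Then for all integers $0\leq j\leq d-1$, $$\lim_{n\rightarrow\infty}\ \sum_{k\geq 0,\ k\equiv j \bmod d}(p^n)_k=\frac 1d,$$ where $(p^n)_k$ denotes the coefficient of $x^k$ in the standard expansion $p^n=(p^n)_0+(p^n)_1x+(p^n)_2x^2+\cdots$.
   Context: A polynomial with positive coefficients means that every coefficient from the constant term up to the leading term is a positive real number. Coefficients of $x^k$ with $k$ greater than the degree are $0$, so the sums are finite. -}

module Defs where

open import Algebra.Bundles using (CommutativeRing; RawSemiring; Semiring)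
import Algebra.Definitions.RawMonoid as RawMonoidDefinitions
open import Data.Bool.Base using (if_then_else_)
open import Data.Fin.Base using (Fin; toℕ)
open import Data.Integer.Base using (+_)
open import Data.List.Base using (List; []; _∷_; length; map; tabulate)
open import Data.Nat.Base as ℕ using (ℕ; zero; suc)
import Data.Nat.Divisibility as ℕ
import Data.Nat.Properties as ℕ
open import Data.Product.Base using (∃-syntax; _×_; _,_)
open import Data.Rational.Base as ℚ using (ℚ; 0ℚ; 1ℚ; ½)
import Data.Rational.Properties as ℚ
open import Data.Rational.Solver using (module +-*-Solver)
open import Data.Sum.Base using (inj₁; inj₂)
open import Data.Vec.Functional using (Vector)
open import Level using (0ℓ)
open import Relation.Binary.PropositionalEquality
open import Relation.Nullary.Decidable using (Dec; does)

infix 4 _≡_[mod_] _≡?_[mod_]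

_≡_[mod_] : ℕ → ℕ → ℕ → Set
k ≡ j [mod d ] = d ℕ.∣ ℕ.∣ k - j ∣

_≡?_[mod_] : ∀ k j d → Dec (k ≡ j [mod d ])
k ≡? j [mod d ] = d ℕ.∣? ℕ.∣ k - j ∣

-- Univariate polynomials over R, as lists of coefficients starting with
-- the constant term. Trailing zeros are allowed; all coefficients past
-- the end of the list are zero.

module Polynomial {c ℓ} (R : RawSemiring c ℓ) where
  open RawSemiring R
  open RawMonoidDefinitions +-rawMonoid public using (sum)

  infixl 6 _⊕_
  infixl 7 _⊗_
  infixr 8 _^_

  Poly : Set c
  Poly = List Carrier

  polynomial : ∀ {n} → Vector Carrier n → Poly
  polynomial = tabulate

  coeff : Poly → ℕ → Carrier
  coeff []      _       = 0#
  coeff (a ∷ _) zero    = a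
  coeff (_ ∷ p) (suc k) = coeff p k

  _⊕_ : Poly → Poly → Poly
  []      ⊕ q       = q
  (a ∷ p) ⊕ []      = a ∷ p
  (a ∷ p) ⊕ (b ∷ q) = (a + b) ∷ (p ⊕ q)

  -- (a + x p) q = a q + x (p q)
  _⊗_ : Poly → Poly → Poly
  []      ⊗ q = []
  (a ∷ p) ⊗ q = map (a *_) q ⊕ (0# ∷ (p ⊗ q))

  _^_ : Poly → ℕ → Poly
  p ^ zero  = 1# ∷ []
  p ^ suc n = p ⊗ (p ^ n)

  -- The sum of the coefficients of xᵏ over all k ≡ j (mod d); the terms
  -- with k ≥ length p vanish.
  residueSum : (d j : ℕ) → Poly → Carrier
  residueSum d j p = sum λ (k : Fin (length p)) →
    if does (toℕ k ≡? j [mod d ]) then coeff p (toℕ k) else 0#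

-- The real numbers, as Cauchy sequences of rationals. Equality is the
-- setoid equality _≈_: the difference tends to zero.

Eventually : (ℕ → Set) → Set
Eventually P = ∃[ N ] ∀ n → N ℕ.≤ n → P n

record ℝ : Set where
  constructor mkℝ
  field
    seq    : ℕ → ℚ
    cauchy : ∀ ε → 0ℚ ℚ.< ε →
             ∃[ N ] ∀ m n → N ℕ.≤ m → N ℕ.≤ n → ℚ.∣ seq m ℚ.- seq n ∣ ℚ.< ε

open ℝ public

infix 4 _≈_ _<_

_≈_ : ℝ → ℝ → Set
x ≈ y = ∀ ε → 0ℚ ℚ.< ε → Eventually λ n → ℚ.∣ seq x n ℚ.- seq y n ∣ ℚ.< ε

-- Termwise strict inequality would not do: the gap must stay bounded
-- away from zero.
_<_ : ℝ → ℝ → Set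
x < y = ∃[ δ ] 0ℚ ℚ.< δ × Eventually λ n → δ ℚ.≤ seq y n ℚ.- seq x n

module _ where
  open +-*-Solver

  private
    0<½ : 0ℚ ℚ.< ½
    0<½ = ℚ.positive⁻¹ ½

  eventually-∧ : ∀ {P Q} → Eventually P → Eventually Q →
                 Eventually λ n → P n × Q n
  eventually-∧ (M , p) (N , q) = M ℕ.⊔ N , λ n le →
    p n (ℕ.≤-trans (ℕ.m≤m⊔n M N) le) , q n (ℕ.≤-trans (ℕ.m≤n⊔m M N) le)

  eventually-map : ∀ {P Q : ℕ → Set} → (∀ n → P n → Q n) →
                   Eventually P → Eventually Q
  eventually-map f (N , p) = N , λ n le → f n (p n le)

  half>0 : ∀ ε → 0ℚ ℚ.< ε → 0ℚ ℚ.< ½ ℚ.* ε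
  half>0 ε 0<ε = ℚ.positive⁻¹ (½ ℚ.* ε)
    {{ℚ.pos*pos⇒pos ½ ε {{ℚ.positive 0<ε}}}}

  half+half : ∀ ε → ½ ℚ.* ε ℚ.+ ½ ℚ.* ε ≡ ε
  half+half ε = trans (sym (ℚ.*-distribʳ-+ ε ½ ½)) (ℚ.*-identityˡ ε)

  scale : ∀ B ε → 0ℚ ℚ.< B → 0ℚ ℚ.< ε → ∃[ δ ] 0ℚ ℚ.< δ × B ℚ.* δ ≡ ε
  scale B ε 0<B 0<ε = 1/B ℚ.* ε , ℚ.positive⁻¹ (1/B ℚ.* ε) {{δ>0}} ,
    trans (sym (ℚ.*-assoc B 1/B ε))
      (trans (cong (ℚ._* ε) (ℚ.*-inverseʳ B)) (ℚ.*-identityˡ ε))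
    where
    instance
      B>0 = ℚ.positive 0<B
      B≢0 = ℚ.pos⇒nonZero B
      ε>0 = ℚ.positive 0<ε
    1/B = ℚ.1/ B
    δ>0 = ℚ.pos*pos⇒pos 1/B {{ℚ.1/pos⇒pos B}} ε

  ∣p-p∣<ε : ∀ {p q} ε → 0ℚ ℚ.< ε → p ≡ q → ℚ.∣ p ℚ.- q ∣ ℚ.< ε
  ∣p-p∣<ε {p} ε 0<ε refl =
    subst (ℚ._< ε) (sym (cong ℚ.∣_∣ (ℚ.+-inverseʳ p))) 0<ε

  ∣p-q∣-comm : ∀ p q → ℚ.∣ p ℚ.- q ∣ ≡ ℚ.∣ q ℚ.- p ∣
  ∣p-q∣-comm p q = trans (sym (ℚ.∣-p∣≡∣p∣ (p ℚ.- q))) (cong ℚ.∣_∣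
    (solve 2 (λ p q → :- (p :- q) := q :- p) refl p q))

  ∣+∣<ε : ∀ p q ε → ℚ.∣ p ∣ ℚ.< ½ ℚ.* ε → ℚ.∣ q ∣ ℚ.< ½ ℚ.* ε →
          ℚ.∣ p ℚ.+ q ∣ ℚ.< ε
  ∣+∣<ε p q ε p< q< = subst (ℚ.∣ p ℚ.+ q ∣ ℚ.<_) (half+half ε)
    (ℚ.≤-<-trans (ℚ.∣p+q∣≤∣p∣+∣q∣ p q) (ℚ.+-mono-< p< q<))

  +-close : ∀ a a′ b b′ ε → ℚ.∣ a ℚ.- a′ ∣ ℚ.< ½ ℚ.* ε →
            ℚ.∣ b ℚ.- b′ ∣ ℚ.< ½ ℚ.* ε →
            ℚ.∣ (a ℚ.+ b) ℚ.- (a′ ℚ.+ b′) ∣ ℚ.< ε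
  +-close a a′ b b′ ε p q = subst (λ z → ℚ.∣ z ∣ ℚ.< ε)
    (solve 4 (λ a a′ b b′ → (a :- a′) :+ (b :- b′) := (a :+ b) :- (a′ :+ b′))
      refl a a′ b b′)
    (∣+∣<ε (a ℚ.- a′) (b ℚ.- b′) ε p q)

  neg-close : ∀ a a′ → ℚ.∣ a ℚ.- a′ ∣ ≡ ℚ.∣ ℚ.- a ℚ.- (ℚ.- a′) ∣
  neg-close a a′ = trans (∣p-q∣-comm a a′) (cong ℚ.∣_∣
    (solve 2 (λ a a′ → a′ :- a := :- a :- (:- a′)) refl a a′))

  ∣*∣<ε : ∀ p q A δ ε → 0ℚ ℚ.< A → A ℚ.* δ ≡ ε →
          ℚ.∣ p ∣ ℚ.< A → ℚ.∣ q ∣ ℚ.< δ → ℚ.∣ p ℚ.* q ∣ ℚ.< ε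
  ∣*∣<ε p q A δ ε 0<A refl p< q< = begin-strict
    ℚ.∣ p ℚ.* q ∣       ≡⟨ ℚ.∣p*q∣≡∣p∣*∣q∣ p q ⟩
    ℚ.∣ p ∣ ℚ.* ℚ.∣ q ∣ ≤⟨ ℚ.*-monoʳ-≤-nonNeg ℚ.∣ q ∣ {{ℚ.nonNegative (ℚ.0≤∣p∣ q)}} (ℚ.<⇒≤ p<) ⟩
    A ℚ.* ℚ.∣ q ∣       <⟨ ℚ.*-monoʳ-<-pos A {{ℚ.positive 0<A}} q< ⟩
    A ℚ.* δ             ∎
    where open ℚ.≤-Reasoning

  ∣seq∣-close : ∀ a b c → ℚ.∣ a ℚ.- b ∣ ℚ.< c → ℚ.∣ a ∣ ℚ.< c ℚ.+ ℚ.∣ b ∣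
  ∣seq∣-close a b c h = subst (λ z → ℚ.∣ z ∣ ℚ.< c ℚ.+ ℚ.∣ b ∣)
    (solve 2 (λ a b → (a :- b) :+ b := a) refl a b)
    (ℚ.≤-<-trans (ℚ.∣p+q∣≤∣p∣+∣q∣ (a ℚ.- b) b)
      (ℚ.+-mono-<-≤ h (ℚ.≤-refl {ℚ.∣ b ∣})))

  eventuallyBounded : ∀ x → ∃[ B ] 0ℚ ℚ.< B × Eventually λ n → ℚ.∣ seq x n ∣ ℚ.< B
  eventuallyBounded x with cauchy x 1ℚ (ℚ.positive⁻¹ 1ℚ)
  ... | N , h = 1ℚ ℚ.+ ℚ.∣ seq x N ∣
    , ℚ.+-mono-<-≤ (ℚ.positive⁻¹ 1ℚ) (ℚ.0≤∣p∣ (seq x N))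
    , N , λ n le → ∣seq∣-close (seq x n) (seq x N) 1ℚ (h n N le ℕ.≤-refl)

  *-close : ∀ a a′ b b′ A B δ δ′ ε → 0ℚ ℚ.< A → 0ℚ ℚ.< B →
            A ℚ.* δ ≡ ½ ℚ.* ε → B ℚ.* δ′ ≡ ½ ℚ.* ε →
            ℚ.∣ a ∣ ℚ.< A → ℚ.∣ b′ ∣ ℚ.< B →
            ℚ.∣ b ℚ.- b′ ∣ ℚ.< δ → ℚ.∣ a ℚ.- a′ ∣ ℚ.< δ′ →
            ℚ.∣ (a ℚ.* b) ℚ.- (a′ ℚ.* b′) ∣ ℚ.< ε
  *-close a a′ b b′ A B δ δ′ ε 0<A 0<B Aδ Bδ a< b< bb aa =
    subst (λ z → ℚ.∣ z ∣ ℚ.< ε)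
      (solve 4 (λ a a′ b b′ → a :* (b :- b′) :+ b′ :* (a :- a′) := (a :* b) :- (a′ :* b′))
        refl a a′ b b′)
      (∣+∣<ε (a ℚ.* (b ℚ.- b′)) (b′ ℚ.* (a ℚ.- a′)) ε
        (∣*∣<ε a (b ℚ.- b′) A δ (½ ℚ.* ε) 0<A Aδ a< bb)
        (∣*∣<ε b′ (a ℚ.- a′) B δ′ (½ ℚ.* ε) 0<B Bδ b< aa))

infix  8 -_
infixl 7 _*_
infixl 6 _+_ _-_

fromℚ : ℚ → ℝ
fromℚ q = mkℝ (λ _ → q) λ ε 0<ε → 0 , λ _ _ _ _ → ∣p-p∣<ε {q} ε 0<ε refl

0ℝ 1ℝ : ℝ
0ℝ = fromℚ 0ℚ
1ℝ = fromℚ 1ℚ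

_+_ : ℝ → ℝ → ℝ
x + y = mkℝ (λ n → seq x n ℚ.+ seq y n) λ ε 0<ε →
  let M , p = cauchy x (½ ℚ.* ε) (half>0 ε 0<ε)
      N , q = cauchy y (½ ℚ.* ε) (half>0 ε 0<ε)
      l = ℕ.m≤m⊔n M N
      r = ℕ.m≤n⊔m M N
  in M ℕ.⊔ N , λ m n hm hn →
    +-close (seq x m) (seq x n) (seq y m) (seq y n) ε
      (p m n (ℕ.≤-trans l hm) (ℕ.≤-trans l hn))
      (q m n (ℕ.≤-trans r hm) (ℕ.≤-trans r hn))

-_ : ℝ → ℝ
- x = mkℝ (λ n → ℚ.- seq x n) λ ε 0<ε →
  let N , p = cauchy x ε 0<ε
  in N , λ m n hm hn →
    subst (ℚ._< ε) (neg-close (seq x m) (seq x n)) (p m n hm hn)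

_-_ : ℝ → ℝ → ℝ
x - y = x + (- y)

_*_ : ℝ → ℝ → ℝ
x * y = mkℝ (λ n → seq x n ℚ.* seq y n) λ ε 0<ε →
  let A , 0<A , K , a = eventuallyBounded x
      B , 0<B , L , b = eventuallyBounded y
      δ  , 0<δ  , Aδ  = scale A (½ ℚ.* ε) 0<A (half>0 ε 0<ε)
      δ′ , 0<δ′ , Bδ′ = scale B (½ ℚ.* ε) 0<B (half>0 ε 0<ε)
      M , p = cauchy x δ′ 0<δ′
      N , q = cauchy y δ 0<δ
      bound = (K ℕ.⊔ L) ℕ.⊔ (M ℕ.⊔ N)
      l = ℕ.m≤m⊔n (K ℕ.⊔ L) (M ℕ.⊔ N)
      r = ℕ.m≤n⊔m (K ℕ.⊔ L) (M ℕ.⊔ N)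
      K≤ = ℕ.≤-trans (ℕ.m≤m⊔n K L) l
      L≤ = ℕ.≤-trans (ℕ.m≤n⊔m K L) l
      M≤ = ℕ.≤-trans (ℕ.m≤m⊔n M N) r
      N≤ = ℕ.≤-trans (ℕ.m≤n⊔m M N) r
  in bound , λ m n hm hn →
    *-close (seq x m) (seq x n) (seq y m) (seq y n) A B δ δ′ ε 0<A 0<B Aδ Bδ′
      (a m (ℕ.≤-trans K≤ hm)) (b n (ℕ.≤-trans L≤ hn))
      (q m n (ℕ.≤-trans N≤ hm) (ℕ.≤-trans N≤ hn))
      (p m n (ℕ.≤-trans M≤ hm) (ℕ.≤-trans M≤ hn))

∣_∣ : ℝ → ℝ
∣ x ∣ = mkℝ (λ n → ℚ.∣ seq x n ∣) λ ε 0<ε →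
  let N , p = cauchy x ε 0<ε
  in N , λ m n hm hn →
    ℚ.≤-<-trans (reverse-triangle (seq x m) (seq x n)) (p m n hm hn)
  where
  open +-*-Solver

  one-sided : ∀ a b → ℚ.∣ a ∣ ℚ.- ℚ.∣ b ∣ ℚ.≤ ℚ.∣ a ℚ.- b ∣
  one-sided a b = begin
    ℚ.∣ a ∣ ℚ.- ℚ.∣ b ∣                         ≡⟨ cong (λ z → ℚ.∣ z ∣ ℚ.- ℚ.∣ b ∣)
                                                    (solve 2 (λ a b → a := (a :- b) :+ b) refl a b) ⟩
    ℚ.∣ (a ℚ.- b) ℚ.+ b ∣ ℚ.- ℚ.∣ b ∣           ≤⟨ ℚ.+-monoˡ-≤ (ℚ.- ℚ.∣ b ∣) (ℚ.∣p+q∣≤∣p∣+∣q∣ (a ℚ.- b) b) ⟩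
    (ℚ.∣ a ℚ.- b ∣ ℚ.+ ℚ.∣ b ∣) ℚ.- ℚ.∣ b ∣     ≡⟨ solve 2 (λ u v → (u :+ v) :- v := u) refl ℚ.∣ a ℚ.- b ∣ ℚ.∣ b ∣ ⟩
    ℚ.∣ a ℚ.- b ∣                               ∎
    where open ℚ.≤-Reasoning

  reverse-triangle : ∀ a b → ℚ.∣ ℚ.∣ a ∣ ℚ.- ℚ.∣ b ∣ ∣ ℚ.≤ ℚ.∣ a ℚ.- b ∣
  reverse-triangle a b with ℚ.∣p∣≡p∨∣p∣≡-p (ℚ.∣ a ∣ ℚ.- ℚ.∣ b ∣)
  ... | inj₁ e = subst (ℚ._≤ ℚ.∣ a ℚ.- b ∣) (sym e) (one-sided a b)
  ... | inj₂ e = subst₂ ℚ._≤_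
    (sym (trans e (solve 2 (λ u v → :- (u :- v) := v :- u) refl ℚ.∣ a ∣ ℚ.∣ b ∣)))
    (∣p-q∣-comm b a) (one-sided b a)

≡⇒≈ : ∀ {x y} → (∀ n → seq x n ≡ seq y n) → x ≈ y
≡⇒≈ {x} {y} h ε 0<ε = 0 , λ n _ → ∣p-p∣<ε {seq x n} {seq y n} ε 0<ε (h n)

≈-sym : ∀ {x y} → x ≈ y → y ≈ x
≈-sym {x} {y} h ε 0<ε = eventually-map
  (λ n → subst (ℚ._< ε) (∣p-q∣-comm (seq x n) (seq y n))) (h ε 0<ε)

≈-trans : ∀ {x y z} → x ≈ y → y ≈ z → x ≈ z
≈-trans {x} {y} {z} h k ε 0<ε = eventually-map
  (λ n (p , q) → subst (λ w → ℚ.∣ w ∣ ℚ.< ε)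
    (solve 3 (λ a b c → (a :- b) :+ (b :- c) := a :- c) refl (seq x n) (seq y n) (seq z n))
    (∣+∣<ε (seq x n ℚ.- seq y n) (seq y n ℚ.- seq z n) ε p q))
  (eventually-∧ (h _ (half>0 ε 0<ε)) (k _ (half>0 ε 0<ε)))
  where open +-*-Solver

+-cong : ∀ {x x′ y y′} → x ≈ x′ → y ≈ y′ → x + y ≈ x′ + y′
+-cong {x} {x′} {y} {y′} h k ε 0<ε = eventually-map
  (λ n (p , q) → +-close (seq x n) (seq x′ n) (seq y n) (seq y′ n) ε p q)
  (eventually-∧ (h _ (half>0 ε 0<ε)) (k _ (half>0 ε 0<ε)))

-‿cong : ∀ {x y} → x ≈ y → - x ≈ - y
-‿cong {x} {y} h ε 0<ε = eventually-map
  (λ n → subst (ℚ._< ε) (neg-close (seq x n) (seq y n))) (h ε 0<ε)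

*-cong : ∀ {x x′ y y′} → x ≈ x′ → y ≈ y′ → x * y ≈ x′ * y′
*-cong {x} {x′} {y} {y′} h k ε 0<ε =
  let A , 0<A , a = eventuallyBounded x
      B , 0<B , b = eventuallyBounded y′
      δ  , 0<δ  , Aδ  = scale A (½ ℚ.* ε) 0<A (half>0 ε 0<ε)
      δ′ , 0<δ′ , Bδ′ = scale B (½ ℚ.* ε) 0<B (half>0 ε 0<ε)
  in eventually-map
    (λ n ((p , q) , (r , s)) →
      *-close (seq x n) (seq x′ n) (seq y n) (seq y′ n) A B δ δ′ ε 0<A 0<B Aδ Bδ′ p q r s)
    (eventually-∧ (eventually-∧ a b) (eventually-∧ (k δ 0<δ) (h δ′ 0<δ′)))

-- Implicit arguments are passed explicitly below because the unfolded _≈_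
-- does not determine them.
+-*-commutativeRing : CommutativeRing 0ℓ 0ℓ
+-*-commutativeRing = record
  { Carrier = ℝ
  ; _≈_ = _≈_
  ; _+_ = _+_
  ; _*_ = _*_
  ; -_ = -_
  ; 0# = 0ℝ
  ; 1# = 1ℝ
  ; isCommutativeRing = record
    { isRing = record
      { +-isAbelianGroup = record
        { isGroup = record
          { isMonoid = record
            { isSemigroup = record
              { isMagma = record
                { isEquivalence = record
                  { refl  = λ {x} → ≡⇒≈ {x} {x} λ _ → refl
                  ; sym   = λ {x} {y} → ≈-sym {x} {y}
                  ; trans = λ {x} {y} {z} → ≈-trans {x} {y} {z}
                  }
                ; ∙-cong = λ {x} {x′} {y} {y′} → +-cong {x} {x′} {y} {y′}
                }
              ; assoc = λ x y z → ≡⇒≈ {(x + y) + z} {x + (y + z)}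
                  λ n → ℚ.+-assoc (seq x n) (seq y n) (seq z n)
              }
            ; identity =
                (λ x → ≡⇒≈ {0ℝ + x} {x} λ n → ℚ.+-identityˡ (seq x n))
              , (λ x → ≡⇒≈ {x + 0ℝ} {x} λ n → ℚ.+-identityʳ (seq x n))
            }
          ; inverse =
              (λ x → ≡⇒≈ { - x + x} {0ℝ} λ n → ℚ.+-inverseˡ (seq x n))
            , (λ x → ≡⇒≈ {x + - x} {0ℝ} λ n → ℚ.+-inverseʳ (seq x n))
          ; ⁻¹-cong = λ {x} {y} → -‿cong {x} {y}
          }
        ; comm = λ x y → ≡⇒≈ {x + y} {y + x} λ n → ℚ.+-comm (seq x n) (seq y n)
        }
      ; *-cong = λ {x} {x′} {y} {y′} → *-cong {x} {x′} {y} {y′}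
      ; *-assoc = λ x y z → ≡⇒≈ {(x * y) * z} {x * (y * z)}
          λ n → ℚ.*-assoc (seq x n) (seq y n) (seq z n)
      ; *-identity =
          (λ x → ≡⇒≈ {1ℝ * x} {x} λ n → ℚ.*-identityˡ (seq x n))
        , (λ x → ≡⇒≈ {x * 1ℝ} {x} λ n → ℚ.*-identityʳ (seq x n))
      ; distrib =
          (λ x y z → ≡⇒≈ {x * (y + z)} {x * y + x * z}
            λ n → ℚ.*-distribˡ-+ (seq x n) (seq y n) (seq z n))
        , (λ x y z → ≡⇒≈ {(y + z) * x} {y * x + z * x}
            λ n → ℚ.*-distribʳ-+ (seq x n) (seq y n) (seq z n))
      }
    ; *-comm = λ x y → ≡⇒≈ {x * y} {y * x} λ n → ℚ.*-comm (seq x n) (seq y n)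
    }
  }

infix 8 1/_

1/_ : (d : ℕ) .{{_ : ℕ.NonZero d}} → ℝ
1/ d = fromℚ (+ 1 ℚ./ d)

open Polynomial (Semiring.rawSemiring (CommutativeRing.semiring +-*-commutativeRing)) public

infix 4 _⟶_

_⟶_ : (ℕ → ℝ) → ℝ → Set
a ⟶ L = ∀ ε → 0ℝ < ε → Eventually λ n → ∣ a n - L ∣ < ε

{-# OPTIONS --safe #-}
-- Let the shift (E f) i = f (i + 1) act on sequences. The sum of (pⁿ)ₖ over
-- k ≡ j (mod d) minus pⁿ(1)/d is (pⁿ(E) f) 0, where f is the indicator of the
-- residue class minus 1/d. All sums of f over d consecutive integers vanish, a
-- property that every q(E) preserves, so subtracting a constant c from the first d
-- coefficients of q does not change q(E) f. If these coefficients are at least c and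
-- the others are nonnegative, then q(E) multiplies the sup norm by at most q(1) - d c.
-- Since p₀, p₁ > 0 this applies to q = p^d and contracts geometrically. Reals are
-- treated through their rational approximations, where p(1) is only close to 1; hence
-- the rational estimates keep track of powers of p(1).

module Submission where

open import Algebra.Bundles using (CommutativeRing)
import Algebra.Properties.Group as GroupProperties
import Algebra.Properties.Semiring.Exp as Exp
open import Data.Bool.Base using (Bool; true; false; if_then_else_)
open import Data.Empty using (⊥-elim)
open import Data.Fin.Base as Fin using (Fin; toℕ)
open import Data.Integer.Base as ℤ using (+_; -[1+_])
import Data.Integer.Properties as ℤ
open import Data.List.Base using ([]; _∷_; length; map; replicate)
open import Data.Nat.Base as ℕ using (ℕ; zero; suc; _∸_; z≤n; s≤s; NonZero)
import Data.Nat.Divisibility as ℕ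
import Data.Nat.Properties as ℕ
open import Data.Product.Base using (∃-syntax; _×_; _,_)
open import Data.Rational.Base as ℚ using (ℚ; 0ℚ; 1ℚ; ½)
import Data.Rational.Properties as ℚ
open import Data.Rational.Solver using (module +-*-Solver)
import Data.Rational.Unnormalised.Base as ℚᵘ
import Data.Rational.Unnormalised.Properties as ℚᵘ
open import Data.Sum.Base using (inj₁; inj₂)
open import Data.Vec.Functional using (Vector)
open import Defs using (module Polynomial; _≡?_[mod_]; scale)
open import Function.Base using (_∘_)
open import Function.Bundles using (_⇔_; mk⇔)
open import Relation.Binary.PropositionalEquality
open import Relation.Nullary.Decidable using (does; dec-true; dec-false; does-⇔; Dec; yes; no)

-- Rational polynomials acting on sequences through the shift.

module RationalPolynomial where
  open import Data.Rational.Base using (_+_; _*_; _-_; -_; _<_; _≤_; ∣_∣)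
  open +-*-Solver using (solve; con; _:=_; _:+_; _:*_; _:-_; :-_)
  open Polynomial ℚ.+-*-rawSemiring public using (Poly; coeff; _⊕_; _⊗_) renaming (_^_ to _^ᵖ_)
  open Exp (CommutativeRing.semiring ℚ.+-*-commutativeRing) public using (_^_; ^-homo-*)

  -- The action of p(E) on sequences, where (E f) i = f (i + 1):
  -- (p ∙ f) i = Σₖ pₖ f (i + k).
  infixr 8 _∙_

  _∙_ : Poly → (ℕ → ℚ) → ℕ → ℚ
  ([]      ∙ f) i = 0ℚ
  ((a ∷ p) ∙ f) i = a * f i + (p ∙ f) (suc i)

  -- The value p(1), which is also the factor by which p(E) multiplies constant sequences.
  mass : Poly → ℚ
  mass []      = 0ℚ
  mass (a ∷ p) = a + mass p

  -- The polynomial 1 + x + ... + x^(n-1). Its action sums windows of n consecutive terms, and its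
  -- mass serves throughout as the number n in ℚ.
  ones : ℕ → Poly
  ones n = replicate n 1ℚ

  ∙-cong : ∀ p {f g} → (∀ i → f i ≡ g i) → ∀ i → (p ∙ f) i ≡ (p ∙ g) i
  ∙-cong []      f≗g i = refl
  ∙-cong (a ∷ p) f≗g i = cong₂ (λ x y → a * x + y) (f≗g i) (∙-cong p f≗g (suc i))

  ∙-suc : ∀ p f i → (p ∙ (f ∘ suc)) i ≡ (p ∙ f) (suc i)
  ∙-suc []      f i = refl
  ∙-suc (a ∷ p) f i = cong (_+_ (a * f (suc i))) (∙-suc p f (suc i))

  ∙-linear : ∀ p a f g i → (p ∙ (λ k → a * f k + g k)) i ≡ a * (p ∙ f) i + (p ∙ g) i
  ∙-linear []      a f g i = solve 1 (λ a → con 0ℚ := a :* con 0ℚ :+ con 0ℚ) refl a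
  ∙-linear (b ∷ p) a f g i rewrite ∙-linear p a f g (suc i) =
    solve 6 (λ a b x y u v → b :* (a :* x :+ y) :+ (a :* u :+ v) := a :* (b :* x :+ u) :+ (b :* y :+ v))
      refl a b (f i) (g i) ((p ∙ f) (suc i)) ((p ∙ g) (suc i))

  ∙-const : ∀ p c i → (p ∙ (λ _ → c)) i ≡ mass p * c
  ∙-const []      c i = sym (ℚ.*-zeroˡ c)
  ∙-const (a ∷ p) c i rewrite ∙-const p c (suc i) = sym (ℚ.*-distribʳ-+ c a (mass p))

  ⊕-∙ : ∀ p q f i → ((p ⊕ q) ∙ f) i ≡ (p ∙ f) i + (q ∙ f) i
  ⊕-∙ []      q       f i = sym (ℚ.+-identityˡ _)
  ⊕-∙ (a ∷ p) []      f i = sym (ℚ.+-identityʳ _)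
  ⊕-∙ (a ∷ p) (b ∷ q) f i rewrite ⊕-∙ p q f (suc i) =
    solve 5 (λ a b x u v → (a :+ b) :* x :+ (u :+ v) := (a :* x :+ u) :+ (b :* x :+ v))
      refl a b (f i) ((p ∙ f) (suc i)) ((q ∙ f) (suc i))

  map-*-∙ : ∀ a q f i → (map (a *_) q ∙ f) i ≡ a * (q ∙ f) i
  map-*-∙ a []      f i = sym (ℚ.*-zeroʳ a)
  map-*-∙ a (b ∷ q) f i rewrite map-*-∙ a q f (suc i) =
    solve 4 (λ a b x u → a :* b :* x :+ a :* u := a :* (b :* x :+ u)) refl a b (f i) ((q ∙ f) (suc i))

  ⊗-∙ : ∀ p q f i → ((p ⊗ q) ∙ f) i ≡ (p ∙ (q ∙ f)) i
  ⊗-∙ []      q f i = refl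
  ⊗-∙ (a ∷ p) q f i
    rewrite ⊕-∙ (map (a *_) q) (0ℚ ∷ (p ⊗ q)) f i | map-*-∙ a q f i | ⊗-∙ p q f (suc i)
    = solve 3 (λ x y z → x :+ (con 0ℚ :* y :+ z) := x :+ z) refl
        (a * (q ∙ f) i) (f i) ((p ∙ (q ∙ f)) (suc i))

  -- Both operators are polynomials in the same shift E. Writing p(E) as a + E p′(E), the induction
  -- needs only that q(E) is linear and commutes with E.
  ∙-swap : ∀ p q f i → (p ∙ (q ∙ f)) i ≡ (q ∙ (p ∙ f)) i
  ∙-swap []      q f i = sym (trans (∙-const q 0ℚ i) (ℚ.*-zeroʳ (mass q)))
  ∙-swap (a ∷ p) q f i = begin
    a * (q ∙ f) i + (p ∙ (q ∙ f)) (suc i)     ≡⟨ cong (_+_ (a * (q ∙ f) i)) (∙-swap p q f (suc i)) ⟩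
    a * (q ∙ f) i + (q ∙ (p ∙ f)) (suc i)     ≡⟨ cong (_+_ (a * (q ∙ f) i)) (∙-suc q (p ∙ f) i) ⟨
    a * (q ∙ f) i + (q ∙ ((p ∙ f) ∘ suc)) i   ≡⟨ ∙-linear q a f ((p ∙ f) ∘ suc) i ⟨
    (q ∙ ((a ∷ p) ∙ f)) i                     ∎
    where open ≡-Reasoning

  ^-+-∙ : ∀ p m n f i → ((p ^ᵖ (m ℕ.+ n)) ∙ f) i ≡ ((p ^ᵖ m) ∙ ((p ^ᵖ n) ∙ f)) i
  ^-+-∙ p zero    n f i =
    sym (trans (ℚ.+-identityʳ _) (ℚ.*-identityˡ (((p ^ᵖ n) ∙ f) i)))
  ^-+-∙ p (suc m) n f i = begin
    ((p ⊗ (p ^ᵖ (m ℕ.+ n))) ∙ f) i            ≡⟨ ⊗-∙ p (p ^ᵖ (m ℕ.+ n)) f i ⟩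
    (p ∙ ((p ^ᵖ (m ℕ.+ n)) ∙ f)) i            ≡⟨ ∙-cong p (^-+-∙ p m n f) i ⟩
    (p ∙ ((p ^ᵖ m) ∙ ((p ^ᵖ n) ∙ f))) i       ≡⟨ ⊗-∙ p (p ^ᵖ m) ((p ^ᵖ n) ∙ f) i ⟨
    ((p ^ᵖ suc m) ∙ ((p ^ᵖ n) ∙ f)) i         ∎
    where open ≡-Reasoning

  -- Products act as compositions, so evaluating on the constant sequence 1 multiplies the masses.
  mass-⊗ : ∀ p q → mass (p ⊗ q) ≡ mass p * mass q
  mass-⊗ p q = begin
    mass (p ⊗ q)                        ≡⟨ ℚ.*-identityʳ _ ⟨
    mass (p ⊗ q) * 1ℚ                   ≡⟨ ∙-const (p ⊗ q) 1ℚ 0 ⟨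
    ((p ⊗ q) ∙ (λ _ → 1ℚ)) 0            ≡⟨ ⊗-∙ p q (λ _ → 1ℚ) 0 ⟩
    (p ∙ (q ∙ (λ _ → 1ℚ))) 0            ≡⟨ ∙-cong p (∙-const q 1ℚ) 0 ⟩
    (p ∙ (λ _ → mass q * 1ℚ)) 0         ≡⟨ ∙-const p (mass q * 1ℚ) 0 ⟩
    mass p * (mass q * 1ℚ)              ≡⟨ cong (mass p *_) (ℚ.*-identityʳ (mass q)) ⟩
    mass p * mass q                     ∎
    where open ≡-Reasoning

  mass-^ : ∀ p n → mass (p ^ᵖ n) ≡ mass p ^ n
  mass-^ p zero    = ℚ.+-identityʳ 1ℚ
  mass-^ p (suc n) = trans (mass-⊗ p (p ^ᵖ n)) (cong (mass p *_) (mass-^ p n))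

  -- Inequalities for products, differences and powers.

  0≤*0≤ : ∀ {a b} → 0ℚ ≤ a → 0ℚ ≤ b → 0ℚ ≤ a * b
  0≤*0≤ {a} {b} 0≤a 0≤b = begin
    0ℚ     ≡⟨ ℚ.*-zeroʳ a ⟨
    a * 0ℚ ≤⟨ ℚ.*-monoˡ-≤-nonNeg a {{ℚ.nonNegative 0≤a}} 0≤b ⟩
    a * b  ∎
    where open ℚ.≤-Reasoning

  *-mono-≤ : ∀ {a b c d} → 0ℚ ≤ a → 0ℚ ≤ d → a ≤ b → c ≤ d → a * c ≤ b * d
  *-mono-≤ {a} {b} {c} {d} 0≤a 0≤d a≤b c≤d = ℚ.≤-trans
    (ℚ.*-monoˡ-≤-nonNeg a {{ℚ.nonNegative 0≤a}} c≤d)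
    (ℚ.*-monoʳ-≤-nonNeg d {{ℚ.nonNegative 0≤d}} a≤b)

  0≤+0≤ : ∀ {a b} → 0ℚ ≤ a → 0ℚ ≤ b → 0ℚ ≤ a + b
  0≤+0≤ = ℚ.+-mono-≤

  ≤⇒0≤- : ∀ {a b} → a ≤ b → 0ℚ ≤ b - a
  ≤⇒0≤- {a} {b} a≤b = begin
    0ℚ     ≡⟨ ℚ.+-inverseʳ a ⟨
    a - a  ≤⟨ ℚ.+-monoˡ-≤ (- a) a≤b ⟩
    b - a  ∎
    where open ℚ.≤-Reasoning

  0<1 : 0ℚ < 1ℚ
  0<1 = ℚ.positive⁻¹ 1ℚ

  0≤1 : 0ℚ ≤ 1ℚ
  0≤1 = ℚ.<⇒≤ 0<1

  ^-pos : ∀ {x} n → 0ℚ < x → 0ℚ < x ^ n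
  ^-pos {x} zero    0<x = 0<1
  ^-pos {x} (suc n) 0<x =
    ℚ.positive⁻¹ (x * x ^ n) {{ℚ.pos*pos⇒pos x {{ℚ.positive 0<x}} (x ^ n) {{ℚ.positive (^-pos n 0<x)}}}}

  ^-nonNeg : ∀ {x} n → 0ℚ ≤ x → 0ℚ ≤ x ^ n
  ^-nonNeg zero    0≤x = 0≤1
  ^-nonNeg (suc n) 0≤x = 0≤*0≤ 0≤x (^-nonNeg n 0≤x)

  ^-≤1 : ∀ {x} n → 0ℚ ≤ x → x ≤ 1ℚ → x ^ n ≤ 1ℚ
  ^-≤1 zero    0≤x x≤1 = ℚ.≤-refl
  ^-≤1 (suc n) 0≤x x≤1 = *-mono-≤ 0≤x 0≤1 x≤1 (^-≤1 n 0≤x x≤1)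

  -- Lower bounds on the coefficients of powers.

  coeff-⊕ : ∀ p q t → coeff (p ⊕ q) t ≡ coeff p t + coeff q t
  coeff-⊕ []      q       t       = sym (ℚ.+-identityˡ _)
  coeff-⊕ (a ∷ p) []      t       = sym (ℚ.+-identityʳ _)
  coeff-⊕ (a ∷ p) (b ∷ q) zero    = refl
  coeff-⊕ (a ∷ p) (b ∷ q) (suc t) = coeff-⊕ p q t

  coeff-map-* : ∀ a q t → coeff (map (a *_) q) t ≡ a * coeff q t
  coeff-map-* a []      t       = sym (ℚ.*-zeroʳ a)
  coeff-map-* a (b ∷ q) zero    = refl
  coeff-map-* a (b ∷ q) (suc t) = coeff-map-* a q t

  coeff-∷-⊗ : ∀ a p q t → coeff ((a ∷ p) ⊗ q) t ≡ a * coeff q t + coeff (0ℚ ∷ (p ⊗ q)) t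
  coeff-∷-⊗ a p q t = trans (coeff-⊕ (map (a *_) q) (0ℚ ∷ (p ⊗ q)) t)
    (cong (_+ coeff (0ℚ ∷ (p ⊗ q)) t) (coeff-map-* a q t))

  NonNeg : Poly → Set
  NonNeg p = ∀ t → 0ℚ ≤ coeff p t

  nonNeg-0∷ : ∀ {p} → NonNeg p → NonNeg (0ℚ ∷ p)
  nonNeg-0∷ 0≤p zero    = ℚ.≤-refl
  nonNeg-0∷ 0≤p (suc t) = 0≤p t

  nonNeg-⊗ : ∀ p q → NonNeg p → NonNeg q → NonNeg (p ⊗ q)
  nonNeg-⊗ []      q 0≤p 0≤q t = ℚ.≤-refl
  nonNeg-⊗ (a ∷ p) q 0≤p 0≤q t = subst (0ℚ ≤_) (sym (coeff-∷-⊗ a p q t))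
    (0≤+0≤ (0≤*0≤ (0≤p zero) (0≤q t))
      (nonNeg-0∷ {p ⊗ q} (nonNeg-⊗ p q (0≤p ∘ suc) 0≤q) t))

  nonNeg-^ : ∀ p n → NonNeg p → NonNeg (p ^ᵖ n)
  nonNeg-^ p zero    0≤p zero    = 0≤1
  nonNeg-^ p zero    0≤p (suc t) = ℚ.≤-refl
  nonNeg-^ p (suc n) 0≤p         = nonNeg-⊗ p (p ^ᵖ n) 0≤p (nonNeg-^ p n 0≤p)

  -- Every summand of the convolution is nonnegative, so keeping only the one from the head gives a
  -- lower bound.
  head-≤-coeff-⊗ : ∀ {c} a p q t → 0ℚ ≤ c → c ≤ a → NonNeg p → NonNeg q →
                   c * coeff q t ≤ coeff ((a ∷ p) ⊗ q) t
  head-≤-coeff-⊗ {c} a p q t 0≤c c≤a 0≤p 0≤q = begin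
    c * coeff q t                              ≤⟨ ℚ.*-monoʳ-≤-nonNeg (coeff q t) {{ℚ.nonNegative (0≤q t)}} c≤a ⟩
    a * coeff q t                              ≡⟨ ℚ.+-identityʳ _ ⟨
    a * coeff q t + 0ℚ                         ≤⟨ ℚ.+-monoʳ-≤ (a * coeff q t) (nonNeg-0∷ {p ⊗ q} (nonNeg-⊗ p q 0≤p 0≤q) t) ⟩
    a * coeff q t + coeff (0ℚ ∷ (p ⊗ q)) t     ≡⟨ coeff-∷-⊗ a p q t ⟨
    coeff ((a ∷ p) ⊗ q) t                      ∎
    where open ℚ.≤-Reasoning

  -- Take the linear term from t of the n factors and the constant term from the others: this single
  -- choice contributes at least c^n to the coefficient of x^t, and all other choices contribute
  -- nonnegatively.
  coeff-^-lower : ∀ {c} a b p → 0ℚ ≤ c → c ≤ a → c ≤ b → NonNeg p →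
                  ∀ n t → t ℕ.≤ n → c ^ n ≤ coeff ((a ∷ b ∷ p) ^ᵖ n) t
  coeff-^-lower {c} a b p 0≤c c≤a c≤b 0≤p = go
    where
    open ℚ.≤-Reasoning

    0≤b∷p : NonNeg (b ∷ p)
    0≤b∷p zero    = ℚ.≤-trans 0≤c c≤b
    0≤b∷p (suc t) = 0≤p t

    0≤a∷b∷p : NonNeg (a ∷ b ∷ p)
    0≤a∷b∷p zero    = ℚ.≤-trans 0≤c c≤a
    0≤a∷b∷p (suc t) = 0≤b∷p t

    go : ∀ n t → t ℕ.≤ n → c ^ n ≤ coeff ((a ∷ b ∷ p) ^ᵖ n) t
    go zero    zero    _         = ℚ.≤-refl
    go (suc n) zero    _         = begin
      c * c ^ n                       ≤⟨ ℚ.*-monoˡ-≤-nonNeg c {{ℚ.nonNegative 0≤c}} (go n zero z≤n) ⟩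
      c * coeff q zero                ≤⟨ head-≤-coeff-⊗ a (b ∷ p) q zero 0≤c c≤a 0≤b∷p 0≤q ⟩
      coeff ((a ∷ b ∷ p) ⊗ q) zero    ∎
      where
      q   = (a ∷ b ∷ p) ^ᵖ n
      0≤q = nonNeg-^ (a ∷ b ∷ p) n 0≤a∷b∷p
    go (suc n) (suc t) (s≤s t≤n) = begin
      c * c ^ n                                       ≤⟨ ℚ.*-monoˡ-≤-nonNeg c {{ℚ.nonNegative 0≤c}} (go n t t≤n) ⟩
      c * coeff q t                                   ≤⟨ head-≤-coeff-⊗ b p q t 0≤c c≤b 0≤p 0≤q ⟩
      coeff ((b ∷ p) ⊗ q) t                           ≡⟨ ℚ.+-identityˡ _ ⟨
      0ℚ + coeff ((b ∷ p) ⊗ q) t                      ≤⟨ ℚ.+-monoˡ-≤ _ (0≤*0≤ (0≤a∷b∷p zero) (0≤q (suc t))) ⟩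
      a * coeff q (suc t) + coeff ((b ∷ p) ⊗ q) t     ≡⟨ coeff-∷-⊗ a (b ∷ p) q (suc t) ⟨
      coeff ((a ∷ b ∷ p) ⊗ q) (suc t)                 ∎
      where
      q   = (a ∷ b ∷ p) ^ᵖ n
      0≤q = nonNeg-^ (a ∷ b ∷ p) n 0≤a∷b∷p

  -- Contraction of the sup norm.

  ∣u*x+z∣≤ : ∀ {u x z r w} → 0ℚ ≤ u → ∣ x ∣ ≤ w → ∣ z ∣ ≤ r * w → ∣ u * x + z ∣ ≤ (u + r) * w
  ∣u*x+z∣≤ {u} {x} {z} {r} {w} 0≤u x≤w z≤rw = begin
    ∣ u * x + z ∣           ≤⟨ ℚ.∣p+q∣≤∣p∣+∣q∣ (u * x) z ⟩
    ∣ u * x ∣ + ∣ z ∣       ≡⟨ cong (_+ ∣ z ∣) (trans (ℚ.∣p*q∣≡∣p∣*∣q∣ u x) (cong (_* ∣ x ∣) (ℚ.0≤p⇒∣p∣≡p 0≤u))) ⟩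
    u * ∣ x ∣ + ∣ z ∣       ≤⟨ ℚ.+-mono-≤ (ℚ.*-monoˡ-≤-nonNeg u {{ℚ.nonNegative 0≤u}} x≤w) z≤rw ⟩
    u * w + r * w           ≡⟨ ℚ.*-distribʳ-+ w u r ⟨
    (u + r) * w             ∎
    where open ℚ.≤-Reasoning

  -- Lowering the first n coefficients by c keeps all coefficients nonnegative, so the triangle
  -- inequality bounds the action by the remaining mass. The lowered polynomial is never formed; the
  -- induction peels off one coefficient at a time.
  ∣∙-ones∣≤ : ∀ {c} n q f {w} → 0ℚ < c → NonNeg q → (∀ t → t ℕ.< n → c ≤ coeff q t) →
              (∀ i → ∣ f i ∣ ≤ w) →
              ∀ i → ∣ (q ∙ f) i - c * (ones n ∙ f) i ∣ ≤ (mass q - c * mass (ones n)) * w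
  ∣∙-ones∣≤ {c} zero    []      f {w} 0<c 0≤q c≤q f≤w i =
    ℚ.≤-reflexive (trans (cong ∣_∣ (solve 1 (λ c → con 0ℚ :- c :* con 0ℚ := con 0ℚ) refl c))
      (solve 2 (λ c w → con 0ℚ := (con 0ℚ :- c :* con 0ℚ) :* w) refl c w))
  -- Coefficients past the end of the list are 0 and cannot be at least the positive c.
  ∣∙-ones∣≤ {c} (suc n) []      f 0<c 0≤q c≤q f≤w i =
    ⊥-elim (ℚ.<-irrefl refl (ℚ.<-≤-trans 0<c (c≤q zero (s≤s z≤n))))
  ∣∙-ones∣≤ {c} zero    (a ∷ q) f {w} 0<c 0≤q c≤q f≤w i = subst₂ _≤_
    (cong ∣_∣ (solve 4 (λ a x y c → a :* x :+ (y :- c :* con 0ℚ) := (a :* x :+ y) :- c :* con 0ℚ)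
      refl a (f i) ((q ∙ f) (suc i)) c))
    (cong (_* w) (solve 3 (λ a m c → a :+ (m :- c :* con 0ℚ) := (a :+ m) :- c :* con 0ℚ) refl a (mass q) c))
    (∣u*x+z∣≤ (0≤q zero) (f≤w i)
      (∣∙-ones∣≤ zero q f 0<c (0≤q ∘ suc) (λ _ ()) f≤w (suc i)))
  ∣∙-ones∣≤ {c} (suc n) (a ∷ q) f {w} 0<c 0≤q c≤q f≤w i = subst₂ _≤_
    (cong ∣_∣ (solve 5 (λ a x y c z → (a :- c) :* x :+ (y :- c :* z) := (a :* x :+ y) :- c :* (con 1ℚ :* x :+ z))
      refl a (f i) ((q ∙ f) (suc i)) c ((ones n ∙ f) (suc i))))
    (cong (_* w) (solve 4 (λ a m c k → (a :- c) :+ (m :- c :* k) := (a :+ m) :- c :* (con 1ℚ :+ k))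
      refl a (mass q) c (mass (ones n))))
    (∣u*x+z∣≤ (≤⇒0≤- (c≤q zero (s≤s z≤n))) (f≤w i)
      (∣∙-ones∣≤ n q f 0<c (0≤q ∘ suc) (λ t t<n → c≤q (suc t) (s≤s t<n)) f≤w (suc i)))

  -- The case n = 0 of the previous bound, where nothing is subtracted and c = 1 is an arbitrary
  -- positive choice.
  ∣∙∣≤ : ∀ q f {w} → NonNeg q → (∀ i → ∣ f i ∣ ≤ w) → ∀ i → ∣ (q ∙ f) i ∣ ≤ mass q * w
  ∣∙∣≤ q f {w} 0≤q f≤w i = subst₂ _≤_
    (cong ∣_∣ (solve 1 (λ x → x :- con 1ℚ :* con 0ℚ := x) refl ((q ∙ f) i)))
    (cong (_* w) (solve 1 (λ x → x :- con 1ℚ :* con 0ℚ := x) refl (mass q)))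
    (∣∙-ones∣≤ zero q f 0<1 0≤q (λ _ ()) f≤w i)

  -- With S = p(1), a block of d factors contracts by S^d - d c^d. The bound S^d ≤ d replaces this
  -- by S^d (1 - c^d), so that the powers of S collect into S^n.
  decay : ∀ {c} a b p d f {w} → 0ℚ < c → c ^ d ≤ 1ℚ → c ≤ a → c ≤ b → NonNeg p →
          mass (a ∷ b ∷ p) ^ d ≤ mass (ones d) →
          (∀ i → (ones d ∙ f) i ≡ 0ℚ) → (∀ i → ∣ f i ∣ ≤ w) →
          ∀ m n → m ℕ.* d ℕ.≤ n →
          ∀ i → ∣ (((a ∷ b ∷ p) ^ᵖ n) ∙ f) i ∣ ≤ mass (a ∷ b ∷ p) ^ n * ((1ℚ - c ^ d) ^ m * w)
  decay {c} a b p′ d f {w} 0<c cᵈ≤1 c≤a c≤b 0≤p′ Sᵈ≤d f-balanced f≤w = go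
    where
    open ℚ.≤-Reasoning
    p = a ∷ b ∷ p′
    S = mass p
    ρ = 1ℚ - c ^ d
    N = mass (ones d)

    0≤c : 0ℚ ≤ c
    0≤c = ℚ.<⇒≤ 0<c

    0≤p : NonNeg p
    0≤p zero          = ℚ.≤-trans 0≤c c≤a
    0≤p (suc zero)    = ℚ.≤-trans 0≤c c≤b
    0≤p (suc (suc t)) = 0≤p′ t

    Sᵈ-cᵈN≤Sᵈρ : S ^ d - c ^ d * N ≤ S ^ d * ρ
    Sᵈ-cᵈN≤Sᵈρ = begin
      S ^ d - c ^ d * N      ≤⟨ ℚ.+-monoʳ-≤ (S ^ d) (ℚ.neg-antimono-≤
                                  (ℚ.*-monoˡ-≤-nonNeg (c ^ d) {{ℚ.nonNegative (^-nonNeg d 0≤c)}} Sᵈ≤d)) ⟩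
      S ^ d - c ^ d * S ^ d  ≡⟨ solve 2 (λ s c → s :- c :* s := s :* (con 1ℚ :- c)) refl (S ^ d) (c ^ d) ⟩
      S ^ d * ρ              ∎

    -- Window sums commute with the action of p^n, which is then applied to the zero sequence.
    balanced : ∀ n i → (ones d ∙ ((p ^ᵖ n) ∙ f)) i ≡ 0ℚ
    balanced n i = trans (∙-swap (ones d) (p ^ᵖ n) f i)
      (trans (∙-cong (p ^ᵖ n) f-balanced i)
        (trans (∙-const (p ^ᵖ n) 0ℚ i) (ℚ.*-zeroʳ (mass (p ^ᵖ n)))))

    step : ∀ n {v} → (∀ i → ∣ ((p ^ᵖ n) ∙ f) i ∣ ≤ v) →
           ∀ i → ∣ ((p ^ᵖ (d ℕ.+ n)) ∙ f) i ∣ ≤ (S ^ d * ρ) * v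
    step n {v} g≤v i = begin
      ∣ ((p ^ᵖ (d ℕ.+ n)) ∙ f) i ∣              ≡⟨ cong ∣_∣ (^-+-∙ p d n f i) ⟩
      -- The inserted 0 is a window sum of `g`, which brings the expression into the form of
      -- `∣∙-ones∣≤`.
      ∣ ((p ^ᵖ d) ∙ g) i ∣                      ≡⟨ cong ∣_∣ (solve 2 (λ x c → x := x :- c :* con 0ℚ) refl _ (c ^ d)) ⟩
      ∣ ((p ^ᵖ d) ∙ g) i - c ^ d * 0ℚ ∣         ≡⟨ cong (λ z → ∣ ((p ^ᵖ d) ∙ g) i - c ^ d * z ∣) (balanced n i) ⟨
      ∣ ((p ^ᵖ d) ∙ g) i - c ^ d * (ones d ∙ g) i ∣
        ≤⟨ ∣∙-ones∣≤ d (p ^ᵖ d) g (^-pos d 0<c) (nonNeg-^ p d 0≤p)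
             (λ t t<d → coeff-^-lower a b p′ 0≤c c≤a c≤b 0≤p′ d t (ℕ.<⇒≤ t<d)) g≤v i ⟩
      (mass (p ^ᵖ d) - c ^ d * N) * v           ≡⟨ cong (λ z → (z - c ^ d * N) * v) (mass-^ p d) ⟩
      (S ^ d - c ^ d * N) * v                   ≤⟨ ℚ.*-monoʳ-≤-nonNeg v {{ℚ.nonNegative 0≤v}} Sᵈ-cᵈN≤Sᵈρ ⟩
      (S ^ d * ρ) * v                           ∎
      where
      g = (p ^ᵖ n) ∙ f
      0≤v : 0ℚ ≤ v
      0≤v = ℚ.≤-trans (ℚ.0≤∣p∣ (g 0)) (g≤v 0)

    go : ∀ m n → m ℕ.* d ℕ.≤ n → ∀ i → ∣ ((p ^ᵖ n) ∙ f) i ∣ ≤ S ^ n * (ρ ^ m * w)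
    -- Factors outside the m blocks are only charged their mass S.
    go zero n _ i = begin
      ∣ ((p ^ᵖ n) ∙ f) i ∣  ≤⟨ ∣∙∣≤ (p ^ᵖ n) f (nonNeg-^ p n 0≤p) f≤w i ⟩
      mass (p ^ᵖ n) * w     ≡⟨ cong₂ _*_ (mass-^ p n) (sym (ℚ.*-identityˡ w)) ⟩
      S ^ n * (1ℚ * w)      ∎
    go (suc m) n md≤n i with n′ , refl ← ℕ.m≤n⇒∃[o]m+o≡n (ℕ.≤-trans (ℕ.m≤m+n d (m ℕ.* d)) md≤n) = begin
      ∣ ((p ^ᵖ (d ℕ.+ n′)) ∙ f) i ∣           ≤⟨ step n′ (go m n′ (ℕ.+-cancelˡ-≤ d _ _ md≤n)) i ⟩
      (S ^ d * ρ) * (S ^ n′ * (ρ ^ m * w))    ≡⟨ solve 5 (λ s r t u w → (s :* r) :* (t :* (u :* w)) := (s :* t) :* ((r :* u) :* w))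
                                                   refl (S ^ d) ρ (S ^ n′) (ρ ^ m) w ⟩
      (S ^ d * S ^ n′) * (ρ ^ suc m * w)      ≡⟨ cong (_* (ρ ^ suc m * w)) (^-homo-* S d n′) ⟨
      S ^ (d ℕ.+ n′) * (ρ ^ suc m * w)        ∎

  -- Natural numbers as rationals, and geometric decay.

  -- Unnormalised rationals are compared by cross-multiplication, so no greatest common divisor
  -- enters the induction.
  toℚᵘ-mass-ones : ∀ n → ℚ.toℚᵘ (mass (ones n)) ℚᵘ.≃ ℚᵘ.mkℚᵘ (+ n) 0
  toℚᵘ-mass-ones zero    = ℚᵘ.≃-refl
  toℚᵘ-mass-ones (suc n) = begin
    ℚ.toℚᵘ (1ℚ + mass (ones n))              ≈⟨ ℚ.toℚᵘ-homo-+ 1ℚ (mass (ones n)) ⟩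
    ℚᵘ.1ℚᵘ ℚᵘ.+ ℚ.toℚᵘ (mass (ones n))       ≈⟨ ℚᵘ.+-congʳ ℚᵘ.1ℚᵘ (toℚᵘ-mass-ones n) ⟩
    ℚᵘ.1ℚᵘ ℚᵘ.+ ℚᵘ.mkℚᵘ (+ n) 0              ≈⟨ ℚᵘ.*≡* (cong (λ k → (+ 1 ℤ.+ k) ℤ.* + 1) (ℤ.*-identityʳ (+ n))) ⟩
    ℚᵘ.mkℚᵘ (+ suc n) 0                      ∎
    where open ℚᵘ.≃-Reasoning

  mass-ones*1/n : ∀ n .{{_ : NonZero n}} → mass (ones n) * (+ 1 ℚ./ n) ≡ 1ℚ
  mass-ones*1/n n@(suc n-1) = ℚ.toℚᵘ-injective (begin
    ℚ.toℚᵘ (mass (ones n) * (+ 1 ℚ./ n))                 ≈⟨ ℚ.toℚᵘ-homo-* (mass (ones n)) (+ 1 ℚ./ n) ⟩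
    ℚ.toℚᵘ (mass (ones n)) ℚᵘ.* ℚ.toℚᵘ (+ 1 ℚ./ n)       ≈⟨ ℚᵘ.*-cong (toℚᵘ-mass-ones n) (ℚ.toℚᵘ-fromℚᵘ (ℚᵘ.mkℚᵘ (+ 1) n-1)) ⟩
    ℚᵘ.mkℚᵘ (+ n) 0 ℚᵘ.* ℚᵘ.mkℚᵘ (+ 1) n-1               ≈⟨ ℚᵘ.*≡* (cong +_ (trans (ℕ.*-identityʳ (n ℕ.* 1)) (trans (ℕ.*-comm n 1) (sym (ℕ.*-identityˡ (1 ℕ.* n)))))) ⟩
    ℚᵘ.1ℚᵘ                                               ∎)
    where open ℚᵘ.≃-Reasoning

  -- A denominator is at least 1, so a nonnegative rational is bounded by its numerator; for a
  -- negative one, 0 suffices.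
  archimedean : ∀ q → ∃[ n ] q ≤ mass (ones n)
  archimedean q@(ℚ.mkℚ (+ k) d-1 _) = k , ℚ.toℚᵘ-cancel-≤ (begin
    ℚ.toℚᵘ q                     ≤⟨ ℚᵘ.*≤* (ℤ.*-monoˡ-≤-nonNeg (+ k) {+ 1} {+ suc d-1} (ℤ.+≤+ (s≤s z≤n))) ⟩
    ℚᵘ.mkℚᵘ (+ k) 0              ≃⟨ toℚᵘ-mass-ones k ⟨
    ℚ.toℚᵘ (mass (ones k))       ∎)
    where open ℚᵘ.≤-Reasoning
  archimedean q@(ℚ.mkℚ -[1+ _ ] _ _) = 0 , ℚ.<⇒≤ (ℚ.negative⁻¹ q)

  0≤mass-ones : ∀ n → 0ℚ ≤ mass (ones n)
  0≤mass-ones zero    = ℚ.≤-refl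
  0≤mass-ones (suc n) = 0≤+0≤ 0≤1 (0≤mass-ones n)

  1≤mass-ones : ∀ n .{{_ : NonZero n}} → 1ℚ ≤ mass (ones n)
  1≤mass-ones (suc n) = subst (_≤ mass (ones (suc n))) (ℚ.+-identityʳ 1ℚ)
    (ℚ.+-monoʳ-≤ 1ℚ (0≤mass-ones n))

  0≤1/n : ∀ n .{{_ : NonZero n}} → 0ℚ ≤ + 1 ℚ./ n
  0≤1/n n = ℚ.nonNegative⁻¹ _ {{ℚ.normalize-nonNeg 1 n}}

  1/n≤1 : ∀ n .{{_ : NonZero n}} → + 1 ℚ./ n ≤ 1ℚ
  1/n≤1 n = begin
    + 1 ℚ./ n                      ≡⟨ ℚ.*-identityˡ _ ⟨
    1ℚ * (+ 1 ℚ./ n)               ≤⟨ ℚ.*-monoʳ-≤-nonNeg _ {{ℚ.nonNegative (0≤1/n n)}} (1≤mass-ones n) ⟩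
    mass (ones n) * (+ 1 ℚ./ n)    ≡⟨ mass-ones*1/n n ⟩
    1ℚ                             ∎
    where open ℚ.≤-Reasoning

  -- Bernoulli's inequality in a form without division. The induction uses (1 - x)(1 + (m + 1)x) = 1
  -- + mx - (m + 1)x² and drops the last term.
  bernoulli : ∀ {x} m → 0ℚ ≤ x → x ≤ 1ℚ → (1ℚ - x) ^ m * (1ℚ + mass (ones m) * x) ≤ 1ℚ
  bernoulli {x} zero    0≤x x≤1 = ℚ.≤-reflexive (solve 1 (λ x → con 1ℚ :* (con 1ℚ :+ con 0ℚ :* x) := con 1ℚ) refl x)
  bernoulli {x} (suc m) 0≤x x≤1 = begin
    (y * u) * (1ℚ + (1ℚ + k) * x)                    ≡⟨ solve 3 (λ x u k →
                                                          ((con 1ℚ :- x) :* u) :* (con 1ℚ :+ (con 1ℚ :+ k) :* x)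
                                                          := u :* (con 1ℚ :+ k :* x) :- u :* ((con 1ℚ :+ k) :* (x :* x)))
                                                          refl x u k ⟩
    u * (1ℚ + k * x) - u * ((1ℚ + k) * (x * x))      ≤⟨ ℚ.+-monoʳ-≤ (u * (1ℚ + k * x)) (ℚ.neg-antimono-≤
                                                          (0≤*0≤ (^-nonNeg m (≤⇒0≤- x≤1))
                                                            (0≤*0≤ (0≤mass-ones (suc m)) (0≤*0≤ 0≤x 0≤x)))) ⟩
    u * (1ℚ + k * x) - 0ℚ                            ≡⟨ ℚ.+-identityʳ _ ⟩
    u * (1ℚ + k * x)                                 ≤⟨ bernoulli m 0≤x x≤1 ⟩
    1ℚ                                               ∎
    where
    open ℚ.≤-Reasoning
    y = 1ℚ - x
    u = y ^ m
    k = mass (ones m)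

  -- Choose m ≥ b = 1/(εx). Then (1 - x)^m (1 + mx) ≤ 1 = εxb ≤ ε(1 + mx), and the positive factor 1
  -- + mx cancels.
  geometric-decay : ∀ {x ε} → 0ℚ < x → x ≤ 1ℚ → 0ℚ < ε → ∃[ m ] (1ℚ - x) ^ m ≤ ε
  geometric-decay {x} {ε} 0<x x≤1 0<ε with scale (ε * x) 1ℚ 0<εx 0<1
    where
    0<εx : 0ℚ < ε * x
    0<εx = ℚ.positive⁻¹ (ε * x) {{ℚ.pos*pos⇒pos ε {{ℚ.positive 0<ε}} x {{ℚ.positive 0<x}}}}
  ... | b , _ , εxb≡1 with archimedean b
  ... | m , b≤m = m , ℚ.*-cancelʳ-≤-pos (1ℚ + k * x) {{ℚ.positive 0<1+kx}} (begin
    (1ℚ - x) ^ m * (1ℚ + k * x)    ≤⟨ bernoulli m 0≤x x≤1 ⟩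
    1ℚ                             ≡⟨ εxb≡1 ⟨
    ε * x * b                      ≤⟨ ℚ.*-monoˡ-≤-nonNeg (ε * x) {{ℚ.nonNegative 0≤εx}} b≤m ⟩
    ε * x * k                      ≡⟨ ℚ.+-identityˡ _ ⟨
    0ℚ + ε * x * k                 ≤⟨ ℚ.+-monoˡ-≤ (ε * x * k) (ℚ.<⇒≤ 0<ε) ⟩
    ε + ε * x * k                  ≡⟨ solve 3 (λ e x k → e :+ e :* x :* k := e :* (con 1ℚ :+ k :* x)) refl ε x k ⟩
    ε * (1ℚ + k * x)               ∎)
    where
    open ℚ.≤-Reasoning
    k = mass (ones m)
    0≤x = ℚ.<⇒≤ 0<x
    0≤εx = 0≤*0≤ (ℚ.<⇒≤ 0<ε) 0≤x
    0<1+kx : 0ℚ < 1ℚ + k * x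
    0<1+kx = ℚ.+-mono-<-≤ 0<1 (0≤*0≤ (0≤mass-ones m) 0≤x)

  -- Window sums and the indicator of a residue class.

  ones-∙-last : ∀ n f i → (ones (suc n) ∙ f) i ≡ (ones n ∙ f) i + f (n ℕ.+ i)
  ones-∙-last zero    f i = solve 1 (λ x → con 1ℚ :* x :+ con 0ℚ := con 0ℚ :+ x) refl (f i)
  ones-∙-last (suc n) f i = begin
    1ℚ * f i + (ones (suc n) ∙ f) (suc i)                 ≡⟨ cong (_+_ (1ℚ * f i)) (ones-∙-last n f (suc i)) ⟩
    1ℚ * f i + ((ones n ∙ f) (suc i) + f (n ℕ.+ suc i))   ≡⟨ ℚ.+-assoc (1ℚ * f i) _ _ ⟨
    (ones (suc n) ∙ f) i + f (n ℕ.+ suc i)                ≡⟨ cong (λ k → (ones (suc n) ∙ f) i + f k) (ℕ.+-suc n i) ⟩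
    (ones (suc n) ∙ f) i + f (suc n ℕ.+ i)                ∎
    where open ≡-Reasoning

  -- The window of length d + 1 at i, split at either end, shows that the windows of length d at i
  -- and i + 1 differ by f (d + i) - f i = 0.
  ones-∙-periodic : ∀ d f → (∀ i → f (d ℕ.+ i) ≡ f i) → ∀ i → (ones d ∙ f) i ≡ (ones d ∙ f) 0
  ones-∙-periodic d f f-periodic zero    = refl
  ones-∙-periodic d f f-periodic (suc i) = trans (GroupProperties.∙-cancelˡ (CommutativeRing.+-group ℚ.+-*-commutativeRing) (f i) _ _ (begin
    f i + (ones d ∙ f) (suc i)         ≡⟨ cong (_+ (ones d ∙ f) (suc i)) (ℚ.*-identityˡ (f i)) ⟨
    (ones (suc d) ∙ f) i               ≡⟨ ones-∙-last d f i ⟩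
    (ones d ∙ f) i + f (d ℕ.+ i)       ≡⟨ cong (_+_ ((ones d ∙ f) i)) (f-periodic i) ⟩
    (ones d ∙ f) i + f i               ≡⟨ ℚ.+-comm _ (f i) ⟩
    f i + (ones d ∙ f) i               ∎)) (ones-∙-periodic d f f-periodic i)
    where open ≡-Reasoning

  χ : (d j : ℕ) → ℕ → ℚ
  χ d j k = if does (k ≡? j [mod d ]) then 1ℚ else 0ℚ

  module _ {d j} (j<d : j ℕ.< d) where

    -- Congruence is tested on the absolute difference t of k and j. Adding d to k turns t into d +
    -- t when j ≤ k, but into d - t when k ≤ j; the latter uses t ≤ j < d.
    ≡[mod]-shift : ∀ k → does (d ℕ.+ k ≡? j [mod d ]) ≡ does (k ≡? j [mod d ])
    ≡[mod]-shift k with ℕ.≤-total j k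
    ... | inj₁ j≤k with t , refl ← ℕ.m≤n⇒∃[o]m+o≡n j≤k =
      does-⇔ (subst₂ (λ x y → d ℕ.∣ x ⇔ d ℕ.∣ y) (sym shifted) (sym unshifted)
        (mk⇔ (λ d∣d+t → ℕ.∣m+n∣m⇒∣n d∣d+t ℕ.∣-refl) (ℕ.∣m∣n⇒∣m+n ℕ.∣-refl)))
        (d ℕ.+ (j ℕ.+ t) ≡? j [mod d ]) (j ℕ.+ t ≡? j [mod d ])
      where
      unshifted : ℕ.∣ j ℕ.+ t - j ∣ ≡ t
      unshifted = trans (ℕ.∣-∣-comm (j ℕ.+ t) j) (ℕ.∣m-m+n∣≡n j t)

      shifted : ℕ.∣ d ℕ.+ (j ℕ.+ t) - j ∣ ≡ d ℕ.+ t
      shifted = begin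
        ℕ.∣ d ℕ.+ (j ℕ.+ t) - j ∣    ≡⟨ ℕ.∣-∣-comm (d ℕ.+ (j ℕ.+ t)) j ⟩
        ℕ.∣ j - d ℕ.+ (j ℕ.+ t) ∣    ≡⟨ cong (ℕ.∣ j -_∣) (ℕ.+-comm d (j ℕ.+ t)) ⟩
        ℕ.∣ j - j ℕ.+ t ℕ.+ d ∣      ≡⟨ cong (ℕ.∣ j -_∣) (ℕ.+-assoc j t d) ⟩
        ℕ.∣ j - j ℕ.+ (t ℕ.+ d) ∣    ≡⟨ ℕ.∣m-m+n∣≡n j (t ℕ.+ d) ⟩
        t ℕ.+ d                      ≡⟨ ℕ.+-comm t d ⟩
        d ℕ.+ t                      ∎
        where open ≡-Reasoning
    ... | inj₂ k≤j with t , refl ← ℕ.m≤n⇒∃[o]m+o≡n k≤j =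
      does-⇔ (subst₂ (λ x y → d ℕ.∣ x ⇔ d ℕ.∣ y) (sym shifted) (sym (ℕ.∣m-m+n∣≡n k t))
        (mk⇔ (ℕ.∣m+n∣m⇒∣n (subst (d ℕ.∣_) (sym [d∸t]+t≡d) ℕ.∣-refl))
             (ℕ.∣m+n∣m⇒∣n (subst (d ℕ.∣_) (sym (ℕ.m+[n∸m]≡n t≤d)) ℕ.∣-refl))))
        (d ℕ.+ k ≡? k ℕ.+ t [mod d ]) (k ≡? k ℕ.+ t [mod d ])
      where
      t≤d : t ℕ.≤ d
      t≤d = ℕ.≤-trans (ℕ.m≤n+m t k) (ℕ.<⇒≤ j<d)

      [d∸t]+t≡d : d ∸ t ℕ.+ t ≡ d
      [d∸t]+t≡d = ℕ.m∸n+n≡m t≤d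

      shifted : ℕ.∣ d ℕ.+ k - k ℕ.+ t ∣ ≡ d ∸ t
      shifted = begin
        ℕ.∣ d ℕ.+ k - k ℕ.+ t ∣    ≡⟨ cong (ℕ.∣_- k ℕ.+ t ∣) (ℕ.+-comm d k) ⟩
        ℕ.∣ k ℕ.+ d - k ℕ.+ t ∣    ≡⟨ ℕ.∣m+n-m+o∣≡∣n-o∣ k d t ⟩
        ℕ.∣ d - t ∣                ≡⟨ ℕ.∣-∣-comm d t ⟩
        ℕ.∣ t - d ∣                ≡⟨ ℕ.m≤n⇒∣m-n∣≡n∸m t≤d ⟩
        d ∸ t                      ∎
        where open ≡-Reasoning

    χ-shift : ∀ k → χ d j (d ℕ.+ k) ≡ χ d j k
    χ-shift k = cong (if_then 1ℚ else 0ℚ) (≡[mod]-shift k)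

    χ-diagonal : χ d j j ≡ 1ℚ
    χ-diagonal = cong (if_then 1ℚ else 0ℚ) (dec-true (j ≡? j [mod d ])
      (subst (d ℕ.∣_) (sym (ℕ.∣n-n∣≡0 j)) (d ℕ.∣0)))

    -- Distinct numbers below d have a positive distance less than d, which d cannot divide.
    χ-off-diagonal : ∀ {k} → k ℕ.< d → k ≢ j → χ d j k ≡ 0ℚ
    χ-off-diagonal {k} k<d k≢j = cong (if_then 1ℚ else 0ℚ) (dec-false (k ≡? j [mod d ]) λ d∣ →
      ℕ.>⇒∤ {{ℕ.≢-nonZero λ eq → k≢j (ℕ.∣m-n∣≡0⇒m≡n eq)}}
        (ℕ.≤-<-trans (ℕ.∣m-n∣≤m⊔n k j) (ℕ.⊔-lub k<d j<d)) d∣)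

    ones-∙-χ-before : ∀ n → n ℕ.≤ j → (ones n ∙ χ d j) 0 ≡ 0ℚ
    ones-∙-χ-before zero    _   = refl
    ones-∙-χ-before (suc n) n<j = begin
      (ones (suc n) ∙ χ d j) 0                ≡⟨ ones-∙-last n (χ d j) 0 ⟩
      (ones n ∙ χ d j) 0 + χ d j (n ℕ.+ 0)    ≡⟨ cong (λ k → (ones n ∙ χ d j) 0 + χ d j k) (ℕ.+-identityʳ n) ⟩
      (ones n ∙ χ d j) 0 + χ d j n            ≡⟨ cong₂ _+_ (ones-∙-χ-before n (ℕ.<⇒≤ n<j))
                                                   (χ-off-diagonal (ℕ.<-trans n<j j<d) (ℕ.<⇒≢ n<j)) ⟩
      0ℚ + 0ℚ                                 ≡⟨⟩
      0ℚ                                      ∎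
      where open ≡-Reasoning

    ones-∙-χ-after : ∀ n → j ℕ.< n → n ℕ.≤ d → (ones n ∙ χ d j) 0 ≡ 1ℚ
    ones-∙-χ-after (suc n) (s≤s j≤n) n<d = begin
      (ones (suc n) ∙ χ d j) 0                ≡⟨ ones-∙-last n (χ d j) 0 ⟩
      (ones n ∙ χ d j) 0 + χ d j (n ℕ.+ 0)    ≡⟨ cong (λ k → (ones n ∙ χ d j) 0 + χ d j k) (ℕ.+-identityʳ n) ⟩
      (ones n ∙ χ d j) 0 + χ d j n            ≡⟨ last (n ℕ.≟ j) ⟩
      1ℚ                                      ∎
      where
      open ≡-Reasoning
      last : Dec (n ≡ j) → (ones n ∙ χ d j) 0 + χ d j n ≡ 1ℚ
      last (yes refl) = cong₂ _+_ (ones-∙-χ-before n ℕ.≤-refl) χ-diagonal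
      last (no n≢j)   = cong₂ _+_ (ones-∙-χ-after n (ℕ.≤∧≢⇒< j≤n (n≢j ∘ sym)) (ℕ.<⇒≤ n<d))
                                  (χ-off-diagonal n<d n≢j)

    -- The window at 0 meets the residue class exactly once, at j, and periodicity carries this
    -- count to every window.
    ones-∙-χ : ∀ i → (ones d ∙ χ d j) i ≡ 1ℚ
    ones-∙-χ i = trans (ones-∙-periodic d (χ d j) χ-shift i) (ones-∙-χ-after d j<d ℕ.≤-refl)

  -- The mass of an approximation is only close to 1, so its d-th power is bounded by 2 instead of
  -- 1; 2 ≤ d then gives the bound by d that `decay` asks for.
  [1+1]≤mass-ones : ∀ n → 2 ℕ.≤ n → 1ℚ + 1ℚ ≤ mass (ones n)
  [1+1]≤mass-ones (suc n@(suc _)) (s≤s (s≤s z≤n)) = ℚ.+-monoʳ-≤ 1ℚ (1≤mass-ones n)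

  -- The centred indicator and the rational error bound.

  module _ (d : ℕ) .{{_ : NonZero d}} {j} (j<d : j ℕ.< d) where

    1/d : ℚ
    1/d = + 1 ℚ./ d

    -- The factor 1 stands for the constant sequence, giving the shape to which `∙-linear` applies.
    χ-centred : ℕ → ℚ
    χ-centred k = - 1/d * 1ℚ + χ d j k

    ∙-χ-centred : ∀ p i → (p ∙ χ-centred) i ≡ - 1/d * mass p + (p ∙ χ d j) i
    ∙-χ-centred p i = trans (∙-linear p (- 1/d) (λ _ → 1ℚ) (χ d j) i)
      (cong (λ z → - 1/d * z + (p ∙ χ d j) i) (trans (∙-const p 1ℚ i) (ℚ.*-identityʳ (mass p))))

    ones-∙-χ-centred : ∀ i → (ones d ∙ χ-centred) i ≡ 0ℚ
    ones-∙-χ-centred i = begin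
      (ones d ∙ χ-centred) i                          ≡⟨ ∙-χ-centred (ones d) i ⟩
      - 1/d * mass (ones d) + (ones d ∙ χ d j) i      ≡⟨ cong (_+_ (- 1/d * mass (ones d))) (ones-∙-χ j<d i) ⟩
      - 1/d * mass (ones d) + 1ℚ                      ≡⟨ solve 2 (λ x n → :- x :* n :+ con 1ℚ := con 1ℚ :- n :* x) refl 1/d (mass (ones d)) ⟩
      1ℚ - mass (ones d) * 1/d                        ≡⟨ cong (_-_ 1ℚ) (mass-ones*1/n d) ⟩
      1ℚ - 1ℚ                                         ≡⟨⟩
      0ℚ                                              ∎
      where open ≡-Reasoning

    ∣χ-centred∣≤1 : ∀ i → ∣ χ-centred i ∣ ≤ 1ℚ
    ∣χ-centred∣≤1 i with does (i ≡? j [mod d ])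
    ... | false = begin
      ∣ - 1/d * 1ℚ + 0ℚ ∣    ≡⟨ cong ∣_∣ (solve 1 (λ x → :- x :* con 1ℚ :+ con 0ℚ := :- x) refl 1/d) ⟩
      ∣ - 1/d ∣              ≡⟨ ℚ.∣-p∣≡∣p∣ 1/d ⟩
      ∣ 1/d ∣                ≡⟨ ℚ.0≤p⇒∣p∣≡p (0≤1/n d) ⟩
      1/d                    ≤⟨ 1/n≤1 d ⟩
      1ℚ                     ∎
      where open ℚ.≤-Reasoning
    ... | true = begin
      ∣ - 1/d * 1ℚ + 1ℚ ∣    ≡⟨ cong ∣_∣ (solve 1 (λ x → :- x :* con 1ℚ :+ con 1ℚ := con 1ℚ :- x) refl 1/d) ⟩
      ∣ 1ℚ - 1/d ∣           ≡⟨ ℚ.0≤p⇒∣p∣≡p (≤⇒0≤- (1/n≤1 d)) ⟩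
      1ℚ - 1/d               ≤⟨ ℚ.+-monoʳ-≤ 1ℚ (ℚ.neg-antimono-≤ (0≤1/n d)) ⟩
      1ℚ - 0ℚ                ≡⟨⟩
      1ℚ                     ∎
      where open ℚ.≤-Reasoning

    -- The error splits into the action on the centred indicator, which decays, and (S^n - 1)/d,
    -- which accounts for the mass S not being exactly 1.
    ∣∙-χ-1/d∣≤ : ∀ {c} a b p → 2 ℕ.≤ d → 0ℚ < c → c ≤ 1ℚ → c ≤ a → c ≤ b → NonNeg p →
                 mass (a ∷ b ∷ p) ^ d ≤ 1ℚ + 1ℚ →
                 ∀ m n → m ℕ.* d ℕ.≤ n →
                 ∣ (((a ∷ b ∷ p) ^ᵖ n) ∙ χ d j) 0 - 1/d ∣ ≤
                 mass (a ∷ b ∷ p) ^ n * (1ℚ - c ^ d) ^ m + ∣ mass (a ∷ b ∷ p) ^ n - 1ℚ ∣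
    ∣∙-χ-1/d∣≤ {c} a b p′ 2≤d 0<c c≤1 c≤a c≤b 0≤p′ Sᵈ≤2 m n md≤n = begin
      ∣ Y - 1/d ∣                                         ≡⟨ cong ∣_∣ (solve 3 (λ y x s → y :- x := (:- x :* s :+ y) :+ (s :- con 1ℚ) :* x) refl Y 1/d (S ^ n)) ⟩
      ∣ (- 1/d * S ^ n + Y) + (S ^ n - 1ℚ) * 1/d ∣        ≡⟨ cong (λ z → ∣ z + (S ^ n - 1ℚ) * 1/d ∣)
                                                               (trans (cong (λ z → - 1/d * z + Y) (sym (mass-^ p n))) (sym (∙-χ-centred (p ^ᵖ n) 0))) ⟩
      ∣ Z + (S ^ n - 1ℚ) * 1/d ∣                          ≤⟨ ℚ.∣p+q∣≤∣p∣+∣q∣ Z ((S ^ n - 1ℚ) * 1/d) ⟩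
      ∣ Z ∣ + ∣ (S ^ n - 1ℚ) * 1/d ∣                      ≤⟨ ℚ.+-mono-≤ ∣Z∣≤ ∣rest∣≤ ⟩
      S ^ n * (1ℚ - c ^ d) ^ m + ∣ S ^ n - 1ℚ ∣           ∎
      where
      open ℚ.≤-Reasoning
      p = a ∷ b ∷ p′
      S = mass p
      Y = ((p ^ᵖ n) ∙ χ d j) 0
      Z = ((p ^ᵖ n) ∙ χ-centred) 0

      ∣Z∣≤ : ∣ Z ∣ ≤ S ^ n * (1ℚ - c ^ d) ^ m
      ∣Z∣≤ = subst (λ z → ∣ Z ∣ ≤ S ^ n * z) (ℚ.*-identityʳ _)
        (decay a b p′ d χ-centred 0<c (^-≤1 d (ℚ.<⇒≤ 0<c) c≤1) c≤a c≤b 0≤p′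
          (ℚ.≤-trans Sᵈ≤2 ([1+1]≤mass-ones d 2≤d)) ones-∙-χ-centred ∣χ-centred∣≤1 m n md≤n 0)

      ∣rest∣≤ : ∣ (S ^ n - 1ℚ) * 1/d ∣ ≤ ∣ S ^ n - 1ℚ ∣
      ∣rest∣≤ = begin
        ∣ (S ^ n - 1ℚ) * 1/d ∣       ≡⟨ ℚ.∣p*q∣≡∣p∣*∣q∣ (S ^ n - 1ℚ) 1/d ⟩
        ∣ S ^ n - 1ℚ ∣ * ∣ 1/d ∣     ≡⟨ cong (_*_ ∣ S ^ n - 1ℚ ∣) (ℚ.0≤p⇒∣p∣≡p (0≤1/n d)) ⟩
        ∣ S ^ n - 1ℚ ∣ * 1/d         ≤⟨ ℚ.*-monoˡ-≤-nonNeg ∣ S ^ n - 1ℚ ∣ {{ℚ.nonNegative (ℚ.0≤∣p∣ (S ^ n - 1ℚ))}} (1/n≤1 d) ⟩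
        ∣ S ^ n - 1ℚ ∣ * 1ℚ          ≡⟨ ℚ.*-identityʳ _ ⟩
        ∣ S ^ n - 1ℚ ∣               ∎

-- Real polynomials read at one index of their Cauchy sequences.

open import Defs
open import Data.Nat.Base using (_≤_)

private
  module ℚ[x] = RationalPolynomial

open ℚ[x] using (mass; _∙_; χ; NonNeg)
open Exp (CommutativeRing.semiring +-*-commutativeRing) using () renaming (_^_ to _^ʳ_)

-- Real sums and products are computed termwise, so this map commutes with the polynomial operations
-- up to propositional equality, not merely up to `_≈_`.
at : ℕ → Poly → ℚ[x].Poly
at k = map (λ x → seq x k)

at-⊕ : ∀ k p q → at k (p ⊕ q) ≡ at k p ℚ[x].⊕ at k q
at-⊕ k []      q       = refl
at-⊕ k (a ∷ p) []      = refl
at-⊕ k (a ∷ p) (b ∷ q) = cong (_ ∷_) (at-⊕ k p q)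

at-map-* : ∀ k a q → at k (map (a *_) q) ≡ map (seq a k ℚ.*_) (at k q)
at-map-* k a []      = refl
at-map-* k a (b ∷ q) = cong (_ ∷_) (at-map-* k a q)

at-⊗ : ∀ k p q → at k (p ⊗ q) ≡ at k p ℚ[x].⊗ at k q
at-⊗ k []      q = refl
at-⊗ k (a ∷ p) q = trans (at-⊕ k (map (a *_) q) (0ℝ ∷ (p ⊗ q)))
  (cong₂ ℚ[x]._⊕_ (at-map-* k a q) (cong (0ℚ ∷_) (at-⊗ k p q)))

at-^ : ∀ k p n → at k (p ^ n) ≡ at k p ℚ[x].^ᵖ n
at-^ k p zero    = refl
at-^ k p (suc n) = trans (at-⊗ k p (p ^ n)) (cong (at k p ℚ[x].⊗_) (at-^ k p n))

-- The predicate is arbitrary because passing to the tail of `p` replaces it by `b ∘ suc`.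
seq-sum-select : ∀ k (b : ℕ → Bool) p →
  seq (sum λ (t : Fin (length p)) → if b (toℕ t) then coeff p (toℕ t) else 0ℝ) k ≡
  (at k p ∙ (λ t → if b t then 1ℚ else 0ℚ)) 0
seq-sum-select k b []      = refl
seq-sum-select k b (a ∷ p) = cong₂ ℚ._+_ (select (b 0))
  (trans (seq-sum-select k (b ∘ suc) p) (ℚ[x].∙-suc (at k p) (λ t → if b t then 1ℚ else 0ℚ) 0))
  where
  select : ∀ b₀ → seq (if b₀ then a else 0ℝ) k ≡ seq a k ℚ.* (if b₀ then 1ℚ else 0ℚ)
  select true  = sym (ℚ.*-identityʳ (seq a k))
  select false = sym (ℚ.*-zeroʳ (seq a k))

seq-residueSum : ∀ k d j p → seq (residueSum d j p) k ≡ (at k p ∙ χ d j) 0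
seq-residueSum k d j p = seq-sum-select k (λ t → does (t ≡? j [mod d ])) p

seq-sum : ∀ k {n} (p : Vector ℝ n) → seq (sum p) k ≡ mass (at k (polynomial p))
seq-sum k {zero}  p = refl
seq-sum k {suc n} p = cong (seq (p Fin.zero) k ℚ.+_) (seq-sum k (p ∘ Fin.suc))

seq-^ : ∀ k x n → seq (x ^ʳ n) k ≡ seq x k ℚ[x].^ n
seq-^ k x zero    = refl
seq-^ k x (suc n) = cong (seq x k ℚ.*_) (seq-^ k x n)

-- Eventual bounds on the approximations.

^-≈1 : ∀ {x} n → x ≈ 1ℝ → x ^ʳ n ≈ 1ℝ
^-≈1 {x} zero    x≈1 = ≡⇒≈ {1ℝ} {1ℝ} λ _ → refl
^-≈1 {x} (suc n) x≈1 = ≈-trans {x * x ^ʳ n} {1ℝ * 1ℝ} {1ℝ}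
  (*-cong {x} {1ℝ} {x ^ʳ n} {1ℝ} x≈1 (^-≈1 {x} n x≈1))
  (≡⇒≈ {1ℝ * 1ℝ} {1ℝ} λ _ → refl)

-- Powers are taken in ℝ, where they respect `_≈_`, and then read termwise. The index from which the
-- bound holds depends on r.
mass^-≈1 : ∀ {n} (p : Vector ℝ n) → sum p ≈ 1ℝ → ∀ r η → 0ℚ ℚ.< η →
           Eventually λ k → ℚ.∣ mass (at k (polynomial p)) ℚ[x].^ r ℚ.- 1ℚ ∣ ℚ.< η
mass^-≈1 p Σp≈1 r η 0<η = eventually-map
  (λ k → subst (λ z → ℚ.∣ z ℚ.- 1ℚ ∣ ℚ.< η)
    (trans (seq-^ k (sum p) r) (cong (ℚ[x]._^ r) (seq-sum k p))))
  (^-≈1 {sum p} r Σp≈1 η 0<η)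

0<⊓ : ∀ {x y} → 0ℚ ℚ.< x → 0ℚ ℚ.< y → 0ℚ ℚ.< x ℚ.⊓ y
0<⊓ {x} {y} 0<x 0<y with ℚ.⊓-sel x y
... | inj₁ x⊓y≡x = subst (0ℚ ℚ.<_) (sym x⊓y≡x) 0<x
... | inj₂ x⊓y≡y = subst (0ℚ ℚ.<_) (sym x⊓y≡y) 0<y

-- The minimum of the finitely many gaps that witness positivity, started at 1 to secure c ≤ 1.
uniformLowerBound : ∀ {n} (p : Vector ℝ n) → (∀ i → 0ℝ < p i) →
                    ∃[ c ] 0ℚ ℚ.< c × c ℚ.≤ 1ℚ × Eventually λ k → ∀ i → c ℚ.≤ seq (p i) k
uniformLowerBound {zero}  p p>0 = 1ℚ , ℚ.positive⁻¹ 1ℚ , ℚ.≤-refl , 0 , λ _ _ ()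
uniformLowerBound {suc n} p p>0 =
  let δ , 0<δ , δ≤p₀       = p>0 Fin.zero
      c , 0<c , c≤1 , c≤p  = uniformLowerBound (p ∘ Fin.suc) (p>0 ∘ Fin.suc)
  in δ ℚ.⊓ c , 0<⊓ 0<δ 0<c , ℚ.≤-trans (ℚ.p⊓q≤q δ c) c≤1 ,
     eventually-map
       (λ k (δ≤ , c≤) → λ where
         Fin.zero    → ℚ.≤-trans (ℚ.p⊓q≤p δ c) (subst (δ ℚ.≤_) (ℚ.+-identityʳ _) δ≤)
         (Fin.suc i) → ℚ.≤-trans (ℚ.p⊓q≤q δ c) (c≤ i))
       (eventually-∧ δ≤p₀ c≤p)

nonNeg-at : ∀ k {n} (p : Vector ℝ n) → (∀ i → 0ℚ ℚ.≤ seq (p i) k) → NonNeg (at k (polynomial p))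
nonNeg-at k {zero}  p 0≤p t       = ℚ.≤-refl
nonNeg-at k {suc n} p 0≤p zero    = 0≤p Fin.zero
nonNeg-at k {suc n} p 0≤p (suc t) = nonNeg-at k (p ∘ Fin.suc) (0≤p ∘ Fin.suc) t

∣x-1∣<1⇒x≤2 : ∀ x → ℚ.∣ x ℚ.- 1ℚ ∣ ℚ.< 1ℚ → x ℚ.≤ 1ℚ ℚ.+ 1ℚ
∣x-1∣<1⇒x≤2 x x≈1 = begin
  x                            ≡⟨ solve 1 (λ x → x := (x :- con 1ℚ) :+ con 1ℚ) refl x ⟩
  (x ℚ.- 1ℚ) ℚ.+ 1ℚ            ≤⟨ ℚ.+-monoˡ-≤ 1ℚ (p≤∣p∣ (x ℚ.- 1ℚ)) ⟩
  ℚ.∣ x ℚ.- 1ℚ ∣ ℚ.+ 1ℚ        ≤⟨ ℚ.+-monoˡ-≤ 1ℚ (ℚ.<⇒≤ x≈1) ⟩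
  1ℚ ℚ.+ 1ℚ                    ∎
  where
  open ℚ.≤-Reasoning
  open +-*-Solver

  p≤∣p∣ : ∀ p → p ℚ.≤ ℚ.∣ p ∣
  p≤∣p∣ p with ℚ.≤-total 0ℚ p
  ... | inj₁ 0≤p = ℚ.≤-reflexive (sym (ℚ.0≤p⇒∣p∣≡p 0≤p))
  ... | inj₂ p≤0 = ℚ.≤-trans p≤0 (ℚ.0≤∣p∣ p)

-- If x uses up at most half of δ, the other half separates x from y, as `_<_` on reals demands.
½-gap : ∀ {δ x y} → δ ℚ.≤ y ℚ.- 0ℚ → x ℚ.≤ ½ ℚ.* δ → ½ ℚ.* δ ℚ.≤ y ℚ.- x
½-gap {δ} {x} {y} δ≤y x≤½δ = begin
  ½ ℚ.* δ                                      ≡⟨ solve 1 (λ z → z := (z :+ z) :- z) refl (½ ℚ.* δ) ⟩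
  (½ ℚ.* δ ℚ.+ ½ ℚ.* δ) ℚ.- ½ ℚ.* δ            ≡⟨ cong (ℚ._- ½ ℚ.* δ) (half+half δ) ⟩
  δ ℚ.- ½ ℚ.* δ                                ≤⟨ ℚ.+-mono-≤ δ≤y (ℚ.neg-antimono-≤ x≤½δ) ⟩
  (y ℚ.- 0ℚ) ℚ.- x                             ≡⟨ cong (ℚ._- x) (ℚ.+-identityʳ y) ⟩
  y ℚ.- x                                      ∎
  where
  open ℚ.≤-Reasoning
  open +-*-Solver using (solve; _:=_; _:+_; _:-_)

-- Convergence of the residue sums.

module _ (d : ℕ) .{{_ : NonZero d}} {j} (2≤d : 2 ≤ d) (j<d : j ℕ.< d)
         {m} (p : Vector ℝ (2 ℕ.+ m)) {c} (0<c : 0ℚ ℚ.< c) (c≤1 : c ℚ.≤ 1ℚ) where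

  -- The decaying term is at most 2 · η/2, because S^n ≤ 2, and the deviation of S^n from 1
  -- contributes at most another η.
  ∣residueSum-1/d∣≤ : ∀ {η} N n → N ℕ.* d ≤ n → (1ℚ ℚ.- c ℚ[x].^ d) ℚ[x].^ N ℚ.≤ ½ ℚ.* η →
    ∀ k → (∀ i → c ℚ.≤ seq (p i) k) →
    ℚ.∣ mass (at k (polynomial p)) ℚ[x].^ d ℚ.- 1ℚ ∣ ℚ.< 1ℚ →
    ℚ.∣ mass (at k (polynomial p)) ℚ[x].^ n ℚ.- 1ℚ ∣ ℚ.< 1ℚ →
    ℚ.∣ mass (at k (polynomial p)) ℚ[x].^ n ℚ.- 1ℚ ∣ ℚ.< η →
    seq ∣ residueSum d j (polynomial p ^ n) - 1/ d ∣ k ℚ.≤ η ℚ.+ η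
  ∣residueSum-1/d∣≤ {η} N n Nd≤n ρᴺ≤½η k c≤p Sᵈ<2 Sⁿ<2 Sⁿ≈1 = begin
    seq ∣ residueSum d j (polynomial p ^ n) - 1/ d ∣ k
      ≡⟨ cong (λ z → ℚ.∣ z ℚ.- (+ 1 ℚ./ d) ∣) (trans (seq-residueSum k d j (polynomial p ^ n))
           (cong (λ q → (q ∙ χ d j) 0) (at-^ k (polynomial p) n))) ⟩
    ℚ.∣ ((at k (polynomial p) ℚ[x].^ᵖ n) ∙ χ d j) 0 ℚ.- (+ 1 ℚ./ d) ∣
      ≤⟨ ℚ[x].∣∙-χ-1/d∣≤ d j<d (seq (p Fin.zero) k) (seq (p (Fin.suc Fin.zero)) k)
           (at k (polynomial (p ∘ Fin.suc ∘ Fin.suc))) 2≤d 0<c c≤1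
           (c≤p Fin.zero) (c≤p (Fin.suc Fin.zero))
           (nonNeg-at k (p ∘ Fin.suc ∘ Fin.suc) (λ i → ℚ.≤-trans (ℚ.<⇒≤ 0<c) (c≤p (Fin.suc (Fin.suc i)))))
           (∣x-1∣<1⇒x≤2 (S ℚ[x].^ d) Sᵈ<2) N n Nd≤n ⟩
    S ℚ[x].^ n ℚ.* ρ ℚ[x].^ N ℚ.+ ℚ.∣ S ℚ[x].^ n ℚ.- 1ℚ ∣
      ≤⟨ ℚ.+-mono-≤
           (ℚ.≤-trans (ℚ.*-monoʳ-≤-nonNeg (ρ ℚ[x].^ N) {{ℚ.nonNegative 0≤ρᴺ}} (∣x-1∣<1⇒x≤2 (S ℚ[x].^ n) Sⁿ<2))
                      (ℚ.*-monoˡ-≤-nonNeg (1ℚ ℚ.+ 1ℚ) ρᴺ≤½η))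
           (ℚ.<⇒≤ Sⁿ≈1) ⟩
    (1ℚ ℚ.+ 1ℚ) ℚ.* (½ ℚ.* η) ℚ.+ η
      ≡⟨ cong (ℚ._+ η) (solve 1 (λ x → (con 1ℚ :+ con 1ℚ) :* (con ½ :* x) := x) refl η) ⟩
    η ℚ.+ η
      ∎
    where
    open ℚ.≤-Reasoning
    open +-*-Solver using (solve; con; _:=_; _:+_; _:*_)
    S = mass (at k (polynomial p))
    ρ = 1ℚ ℚ.- c ℚ[x].^ d

    0≤ρᴺ : 0ℚ ℚ.≤ ρ ℚ[x].^ N
    0≤ρᴺ = ℚ[x].^-nonNeg N (ℚ[x].≤⇒0≤- (ℚ[x].^-≤1 d (ℚ.<⇒≤ 0<c) c≤1))

  residueSum⟶1/d : (Eventually λ k → ∀ i → c ℚ.≤ seq (p i) k) → sum p ≈ 1ℝ →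
                   (λ n → residueSum d j (polynomial p ^ n)) ⟶ 1/ d
  residueSum⟶1/d c≤p Σp≈1 ε (δ , 0<δ , δ≤ε) = beyond
    (ℚ[x].geometric-decay (ℚ[x].^-pos d 0<c) (ℚ[x].^-≤1 d (ℚ.<⇒≤ 0<c) c≤1) (half>0 η 0<η))
    where
    a : ℕ → ℝ
    a n = residueSum d j (polynomial p ^ n)

    -- A quarter of δ: the two errors together stay within half of δ.
    η : ℚ
    η = ½ ℚ.* (½ ℚ.* δ)

    0<η : 0ℚ ℚ.< η
    0<η = half>0 (½ ℚ.* δ) (half>0 δ 0<δ)

    0<1 : 0ℚ ℚ.< 1ℚ
    0<1 = ℚ.positive⁻¹ 1ℚ

    S : ℕ → ℚ
    S k = mass (at k (polynomial p))

    gap : ∀ N n → N ℕ.* d ≤ n → (1ℚ ℚ.- c ℚ[x].^ d) ℚ[x].^ N ℚ.≤ ½ ℚ.* η → ∀ k →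
      ((δ ℚ.≤ seq ε k ℚ.- 0ℚ) × (∀ i → c ℚ.≤ seq (p i) k)) ×
      (ℚ.∣ S k ℚ[x].^ d ℚ.- 1ℚ ∣ ℚ.< 1ℚ) ×
      (ℚ.∣ S k ℚ[x].^ n ℚ.- 1ℚ ∣ ℚ.< 1ℚ) ×
      (ℚ.∣ S k ℚ[x].^ n ℚ.- 1ℚ ∣ ℚ.< η) →
      ½ ℚ.* δ ℚ.≤ seq ε k ℚ.- seq ∣ a n - 1/ d ∣ k
    gap N n Nd≤n ρᴺ≤½η k ((δ≤εₖ , c≤pₖ) , Sᵈ<2 , Sⁿ<2 , Sⁿ≈1) =
      ½-gap {δ} {seq ∣ a n - 1/ d ∣ k} {seq ε k} δ≤εₖ
        (subst (seq ∣ a n - 1/ d ∣ k ℚ.≤_) (half+half (½ ℚ.* δ))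
          (∣residueSum-1/d∣≤ N n Nd≤n ρᴺ≤½η k c≤pₖ Sᵈ<2 Sⁿ<2 Sⁿ≈1))

    beyond : ∃[ N ] (1ℚ ℚ.- c ℚ[x].^ d) ℚ[x].^ N ℚ.≤ ½ ℚ.* η →
             Eventually λ n → ∣ a n - 1/ d ∣ < ε
    -- The threshold for n depends only on c, d and δ. For each fixed n, the bounds hold from some
    -- index k on that may depend on n, because `_<_` is an eventual statement about approximations.
    beyond (N , ρᴺ≤½η) = N ℕ.* d , λ n Nd≤n →
      ½ ℚ.* δ , half>0 δ 0<δ , eventually-map (gap N n Nd≤n ρᴺ≤½η)
      (eventually-∧ (eventually-∧ δ≤ε c≤p)
        (eventually-∧ (mass^-≈1 p Σp≈1 d 1ℚ 0<1)
          (eventually-∧ (mass^-≈1 p Σp≈1 n 1ℚ 0<1) (mass^-≈1 p Σp≈1 n η 0<η))))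

theorem1 : (d : ℕ) .{{_ : NonZero d}} → 2 ≤ d →
    (m : ℕ) → 1 ≤ m → (p : Vector ℝ (suc m)) →
    ((i : Fin (suc m)) → 0ℝ < p i) → sum p ≈ 1ℝ →
    (j : ℕ) → j ≤ d ∸ 1 →
    (λ n → residueSum d j (polynomial p ^ n)) ⟶ 1/ d
theorem1 d 2≤d (suc m) 1≤m p p>0 Σp≈1 j j≤d-1 =
  let c , 0<c , c≤1 , c≤p = uniformLowerBound p p>0
      -- As d is nonzero, d ∸ 1 is its true predecessor.
      j<d = subst (suc j ≤_) (ℕ.suc-pred d) (s≤s j≤d-1)
  in residueSum⟶1/d d 2≤d j<d p 0<c c≤1 c≤p Σp≈1
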